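{- Let $m, n, r, q$ be positive integers with $$n> 2m+\frac{ -1+\sqrt{8m^2-16m-7}}{2}.$$ Let $\mathcal F=K_m^3$ be the complete $3$-uniform hypergraph on a vertex set $V$ with $|V|=m$, and let a $q$-hyperedge-coloring of $\mathcal F$ be given. For each color $j\in\{1,\dots,q\}$ let $\mathcal F(j)$ denote the sub-hypergraph of $\mathcal F$ on $V$ formed by the hyperedges of color $j$, and $d_{\mathcal F(j)}(v)$ the number of hyperedges of color $j$ containing $v$. Then this hyperedge-coloring of $\mathcal F$ can be embedded into an $r$-factorization of $\mathcal G=K_n^3$ if and only if all of the following hold: (i) $3 \mid rn$; (ii) $r \mid \binom{n-1}{2}$; (iii) $q\leq \binom{n-1}{2}/r$; (iv) $d_{\mathcal F(j)}(v)\leq r$ for each $v\in V$ and each $1\leq j\leq q$.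
   Context: $K_n^3$ denotes the complete $3$-uniform hypergraph on $n$ vertices: every set of $3$ distinct vertices is a hyperedge, exactly once. A $q$-hyperedge-coloring of a hypergraph is a map from its hyperedge set to a set of $q$ colors; the hyperedges of one color form a color class. The degree of a vertex is the number of hyperedges containing it. An $r$-factor of a hypergraph is a spanning sub-hypergraph in which every vertex has degree $r$; an $r$-factorization is a partition of the hyperedge set into $r$-factors (equivalently a hyperedge-coloring in which each color class is an $r$-factor). The coloring of $K_m^3$ is embedded into an $r$-factorization of $K_n^3$ if $K_n^3$ is taken on a vertex set $V\cup U$ with $U$ disjoint from $V$, $|U|=n-m$ (so the hyperedges of $K_n^3$ inside $V$ are exactly those of $K_m^3$), and there is a hyperedge-coloring of $K_n^3$ extending the given coloring of $K_m^3$ (the hyperedges within $V$ keep their given colors) in which every color class is an $r$-factor of $K_n^3$. -}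

module Defs where

open import Data.Nat using (ℕ; zero; suc; _+_; _*_; _∸_; _≤_; _<_; s≤s; z≤n)
open import Data.Nat.Properties using (≤-trans; <-≤-trans; ≰⇒>; _≤?_; *-monoʳ-≤; *-monoˡ-≤; ≤-refl; +-monoʳ-≤; m≤m+n; n≤1+n)
open import Data.Fin using (Fin; toℕ; inject≤) renaming (_<_ to _<ᶠ_)
open import Data.Fin.Properties using (toℕ-inject≤; _≟_) renaming (_<?_ to _<ᶠ?_)
open import Data.Product using (Σ; _×_; _,_; ∃-syntax)
open import Relation.Nullary using (yes; no; ¬_)
open import Relation.Binary.PropositionalEquality using (_≡_; subst; sym)
open import Data.Empty using (⊥-elim)

-- A hyperedge of K_n^3 on vertex set Fin n: a 3-element set {a,b,c},
-- represented uniquely by its increasing listing a < b < c.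
-- (The order proofs are irrelevant, so a hyperedge is determined by a,b,c.)
record Triple (n : ℕ) : Set where
  constructor tri
  field
    fst snd thd : Fin n
    .fst<snd : fst <ᶠ snd
    .snd<thd : snd <ᶠ thd
open Triple public

sumFin : ∀ {n} → (Fin n → ℕ) → ℕ
sumFin {zero}  f = 0
sumFin {suc n} f = f Fin.zero + sumFin (λ i → f (Fin.suc i))
  where import Data.Fin as Fin

contrib : ∀ {n k} → (Triple n → Fin k) → Fin k → Fin n → Fin n → Fin n → Fin n → ℕ
contrib c j v a b d with a <ᶠ? b | b <ᶠ? d
... | yes p | yes q with c (tri a b d p q) ≟ j
...   | no _ = 0
...   | yes _ with v ≟ a | v ≟ b | v ≟ d
...     | no _ | no _ | no _ = 0
...     | _    | _    | _    = 1
contrib c j v a b d | _ | _ = 0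

deg : ∀ {n k} → (Triple n → Fin k) → Fin k → Fin n → ℕ
deg c j v = sumFin λ a → sumFin λ b → sumFin λ d → contrib c j v a b d

IsRFactor : ∀ {n k} → ℕ → (Triple n → Fin k) → Fin k → Set
IsRFactor r c j = ∀ v → deg c j v ≡ r

embTriple : ∀ {m n} → .(m ≤ n) → Triple m → Triple n
embTriple m≤n (tri a b d p q) =
  tri (inject≤ a m≤n) (inject≤ b m≤n) (inject≤ d m≤n)
      (subst₂ _<_ (sym (toℕ-inject≤ a m≤n)) (sym (toℕ-inject≤ b m≤n)) p)
      (subst₂ _<_ (sym (toℕ-inject≤ b m≤n)) (sym (toℕ-inject≤ d m≤n)) q)
  where open import Relation.Binary.PropositionalEquality using (subst₂)

Embeds : ∀ {m n q} → .(m ≤ n) → ℕ → (Triple m → Fin q) → Set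
Embeds {m} {n} {q} m≤n r col =
  ∃[ k ] Σ (q ≤ k) λ q≤k → ∃[ c ]
     ((∀ (e : Triple m) → c (embTriple m≤n e) ≡ inject≤ (col e) q≤k)
     × (∀ (j : Fin k) → IsRFactor {n} r c j))

bound⇒m≤n : ∀ {m n} → 4 * m < 2 * n + 1 → m ≤ n
bound⇒m≤n {m} {n} h with m ≤? n
... | yes p = p
... | no np = ⊥-elim (lt h')
  where
  open Data.Nat.Properties using (<-irrefl; ≤-<-trans; +-comm; *-comm)
  import Data.Nat.Properties
  -- n < m, so 2n + 1 ≤ 2m ≤ 4m
  n<m : n < m
  n<m = ≰⇒> np
  h' : 2 * n + 1 ≤ 4 * m
  h' = ≤-trans (subst (_≤ 2 * m) (+-comm 1 (2 * n))
                 (≤-trans (n≤1+n _) (subst (_≤ 2 * m) (Data.Nat.Properties.*-suc 2 n) (*-monoʳ-≤ 2 n<m))))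
               (*-monoˡ-≤ m {2} {4} (s≤s (s≤s z≤n)))
  lt : 2 * n + 1 ≤ 4 * m → _
  lt p = <-irrefl Relation.Binary.PropositionalEquality.refl (<-≤-trans h p)
    where import Relation.Binary.PropositionalEquality

{-# OPTIONS --safe #-}
-- Merge the n - m new vertices into one. The given colouring is first extended to this
-- amalgamated hypergraph: the hyperedges with one new vertex are coloured greedily (the hypothesis
-- on n is exactly what keeps a colour with degree below r at both old endpoints available), those
-- with two new vertices supply the degrees still missing, those with three the missing class sizes.
-- Then the new vertices are split off one at a time, as in Baranyai's theorem: when p vertices are
-- still merged, dividing among them the hyperedges of each kind and colour equally is a fractional
-- solution of a transportation problem with integral marginals, so an integral solution exists.
module Submission where

open import Defs
open import Data.Bool using (Bool; true; false; _∧_; _∨_; not; if_then_else_)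
import Data.Bool.Properties as Bool
open import Data.Nat
open import Data.Nat.Properties
open import Data.Nat.Combinatorics using (_C_; nC1≡n; nCk+nC[k+1]≡[n+1]C[k+1])
open import Data.Nat.Divisibility using (_∣_; divides)
open import Data.Nat.DivMod using (m*n/n≡m; m/n*n≡m)
open import Data.Nat.Tactic.RingSolver using (solve-∀)
open import Data.Fin using (Fin; toℕ; fromℕ<; inject≤)
import Data.Fin as Fin
import Data.Fin.Properties as Fin
import Data.Fin.Permutation.Components as Components
open import Data.List using (List; []; _∷_; _++_; map; downFrom; allFin; tabulate; cartesianProduct)
open import Data.List.Membership.Propositional using (_∈_)
open import Data.List.Membership.Propositional.Properties using (∈-cartesianProduct⁺; ∈-allFin)
open import Data.List.Relation.Unary.All as All using (All; []; _∷_)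
import Data.List.Relation.Unary.All.Properties as All
open import Data.List.Relation.Unary.Any using (here; there)
open import Data.Vec using (Vec; []; _∷_)
open import Data.Vec.Properties using () renaming (≡-dec to Vec-≡-dec)
open import Data.Product using (_×_; _,_; proj₁; proj₂; ∃-syntax)
open import Data.Sum using (_⊎_; inj₁; inj₂)
open import Function using (_∘_; id)
open import Function.Bundles using (_⇔_; mk⇔)
open import Relation.Binary using (DecidableEquality)
open import Relation.Binary.PropositionalEquality
open import Relation.Nullary using (¬_; yes; no; does; contradiction)
open import Relation.Nullary.Decidable using (dec-true; dec-false; recompute; does-⇔)

-- The number of colours is forced: summing degrees at one vertex gives `k * r = C(n-1,2)`, and
-- colours beyond `q` start empty. Put `p = n - m`. A hyperedge formed by an old pair `uv` and one
-- new vertex lacks an admissible colour only if each of the `k` colours is full at `u` or at `v`,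
-- so that the two degrees sum to at least `k * r`. But `u` and `v` each still miss their `C(p,2)`
-- hyperedges with two new vertices and the very copy of `uv` to be coloured, so this sum is at most
-- `2 * (k * r - C(p,2) - 1)`. Hence `C(n-1,2) < 2 * C(p,2) + 2` suffices, and solving it for `n`
-- produces the square root in the theorem. Completing the class sizes meets a second obstacle: a
-- class must not be too large already. With all old degrees equal to `r` it may have `m * r`
-- hyperedges, while its final size is `r * n / 3`, so `n >= 3 * m` is wanted. The bound on `n`
-- yields this only for `m >= 4`. For `m <= 3` at most one hyperedge is given, so all `n` vertices
-- can be merged instead and the colours renamed at the end.

private variable
  A B : Set

-- Finite sums and enumerated types

does-sym : ∀ {A : Set} (_≟_ : DecidableEquality A) x y → does (x ≟ y) ≡ does (y ≟ x)
does-sym _≟_ x y with x ≟ y | y ≟ x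
... | yes _ | yes _ = refl
... | no _  | no _  = refl
... | yes e | no ¬e = contradiction (sym e) ¬e
... | no ¬e | yes e = contradiction (sym e) ¬e

0<n∸m⇒m<n : ∀ {m n} → 0 < n ∸ m → m < n
0<n∸m⇒m<n h = ≰⇒> λ n≤m → m<n⇒n≢0 h (m≤n⇒m∸n≡0 n≤m)

⟦_⟧ : Bool → ℕ
⟦ false ⟧ = 0
⟦ true ⟧ = 1

∑ : List A → (A → ℕ) → ℕ
∑ [] f = 0
∑ (x ∷ xs) f = f x + ∑ xs f

∑-cong : ∀ (xs : List A) {f g} → (∀ x → f x ≡ g x) → ∑ xs f ≡ ∑ xs g
∑-cong [] h = refl
∑-cong (x ∷ xs) h = cong₂ _+_ (h x) (∑-cong xs h)

∑-mono : ∀ (xs : List A) {f g} → (∀ x → f x ≤ g x) → ∑ xs f ≤ ∑ xs g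
∑-mono [] h = z≤n
∑-mono (x ∷ xs) h = +-mono-≤ (h x) (∑-mono xs h)

+-interchange : ∀ a b c d → (a + b) + (c + d) ≡ (a + c) + (b + d)
+-interchange = solve-∀

∑-+ : ∀ (xs : List A) f g → ∑ xs (λ x → f x + g x) ≡ ∑ xs f + ∑ xs g
∑-+ [] f g = refl
∑-+ (x ∷ xs) f g = trans (cong (f x + g x +_) (∑-+ xs f g)) (+-interchange (f x) (g x) _ _)

∑-*ˡ : ∀ (xs : List A) c f → ∑ xs (λ x → c * f x) ≡ c * ∑ xs f
∑-*ˡ [] c f = sym (*-zeroʳ c)
∑-*ˡ (x ∷ xs) c f = trans (cong (c * f x +_) (∑-*ˡ xs c f)) (sym (*-distribˡ-+ c (f x) _))

∑-*ʳ : ∀ (xs : List A) c f → ∑ xs (λ x → f x * c) ≡ ∑ xs f * c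
∑-*ʳ xs c f = trans (∑-cong xs λ x → *-comm (f x) c) (trans (∑-*ˡ xs c f) (*-comm c _))

∑-0 : ∀ (xs : List A) → ∑ xs (λ _ → 0) ≡ 0
∑-0 [] = refl
∑-0 (x ∷ xs) = ∑-0 xs

∑-swap : ∀ (xs : List A) (ys : List B) (f : A → B → ℕ) →
         ∑ xs (λ x → ∑ ys (f x)) ≡ ∑ ys (λ y → ∑ xs (λ x → f x y))
∑-swap [] ys f = sym (∑-0 ys)
∑-swap (x ∷ xs) ys f = trans (cong (∑ ys (f x) +_) (∑-swap xs ys f)) (sym (∑-+ ys (f x) _))

∑-++ : ∀ (xs ys : List A) f → ∑ (xs ++ ys) f ≡ ∑ xs f + ∑ ys f
∑-++ [] ys f = refl
∑-++ (x ∷ xs) ys f = trans (cong (f x +_) (∑-++ xs ys f)) (sym (+-assoc (f x) _ _))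

∑-map : ∀ (g : A → B) (xs : List A) f → ∑ (map g xs) f ≡ ∑ xs (λ x → f (g x))
∑-map g [] f = refl
∑-map g (x ∷ xs) f = cong (f (g x) +_) (∑-map g xs f)

∑-positive : ∀ (xs : List A) f → 0 < ∑ xs f → ∃[ x ] 0 < f x
∑-positive (x ∷ xs) f h with f x in eq
... | zero  = ∑-positive xs f h
... | suc _ = x , subst (0 <_) (sym eq) z<s

-- `once` states membership and absence of duplicates in one equation, in the form that lets a
-- Kronecker delta collapse a sum.
record Enum (A : Set) : Set where
  infix 4 _≟ₑ_
  field
    elems : List A
    _≟ₑ_  : DecidableEquality A

  δ : A → A → ℕ
  δ x y = ⟦ does (x ≟ₑ y) ⟧

  field
    once : ∀ a → ∑ elems (λ x → δ x a) ≡ 1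

  total : (A → ℕ) → ℕ
  total = ∑ elems

  δ-refl : ∀ a → δ a a ≡ 1
  δ-refl a = cong ⟦_⟧ (dec-true (a ≟ₑ a) refl)

  δ-* : ∀ f x a → δ x a * f x ≡ δ x a * f a
  δ-* f x a with x ≟ₑ a
  ... | yes refl = refl
  ... | no _     = refl

  total-δ : ∀ f a → total (λ x → δ x a * f x) ≡ f a
  total-δ f a = begin
    total (λ x → δ x a * f x) ≡⟨ ∑-cong elems (λ x → δ-* f x a) ⟩
    total (λ x → δ x a * f a) ≡⟨ ∑-*ʳ elems (f a) (λ x → δ x a) ⟩
    total (λ x → δ x a) * f a ≡⟨ cong (_* f a) (once a) ⟩
    1 * f a                   ≡⟨ *-identityˡ (f a) ⟩
    f a                       ∎
    where open ≡-Reasoning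

  δ-*-≤ : ∀ x a y → δ x a * y ≤ y
  δ-*-≤ x a y with does (x ≟ₑ a)
  ... | false = z≤n
  ... | true  = ≤-reflexive (*-identityˡ y)

  term≤total : ∀ f a → f a ≤ total f
  term≤total f a = subst (_≤ total f) (total-δ f a) (∑-mono elems λ x → δ-*-≤ x a (f x))

  search : ∀ f → (∃[ a ] 0 < f a) ⊎ (∀ a → f a ≡ 0)
  search f with total f in eq
  ... | zero  = inj₂ λ a → n≤0⇒n≡0 (subst (f a ≤_) eq (term≤total f a))
  ... | suc _ = inj₁ (∑-positive elems f (subst (0 <_) (sym eq) z<s))

  total-mono-< : ∀ {f g} → (∀ x → f x ≤ g x) → ∀ a → f a < g a → total f < total g
  total-mono-< {f} {g} f≤g a fa<ga = begin-strict
    total f                                ≡⟨ sym (+-identityʳ _) ⟩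
    total f + 0                            <⟨ +-monoʳ-< (total f) z<s ⟩
    total f + 1                            ≡⟨ cong (total f +_) (sym (once a)) ⟩
    total f + total (λ x → δ x a)          ≡⟨ sym (∑-+ elems f _) ⟩
    total (λ x → f x + δ x a)              ≤⟨ ∑-mono elems bound ⟩
    total g                                ∎
    where
    open ≤-Reasoning
    bound : ∀ x → f x + δ x a ≤ g x
    bound x with x ≟ₑ a
    ... | yes refl = subst (_≤ g x) (+-comm 1 (f x)) fa<ga
    ... | no _     = subst (_≤ g x) (sym (+-identityʳ (f x))) (f≤g x)

  total-tight : ∀ {f g} → (∀ x → f x ≤ g x) → total f ≡ total g → ∀ a → f a ≡ g a
  total-tight f≤g eq a with m≤n⇒m<n∨m≡n (f≤g a)
  ... | inj₁ lt = contradiction eq (<⇒≢ (total-mono-< f≤g a lt))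
  ... | inj₂ e  = e

-- Integral transportation by augmenting paths

-- Integrality of transportation: the fractional matrix F / p can be rounded to an integral one
-- below cap with the same marginals.
module Rounding {A B : Set} (EA : Enum A) (EB : Enum B)
  (cap F : A → B → ℕ) (p : ℕ) .{{_ : NonZero p}} (R : A → ℕ) (C : B → ℕ)
  (F≤cap : ∀ a b → F a b ≤ p * cap a b)
  (F-row : ∀ a → ∑ (Enum.elems EB) (F a) ≡ p * R a)
  (F-col : ∀ b → ∑ (Enum.elems EA) (λ a → F a b) ≡ p * C b)
  where

  module EA = Enum EA
  module EB = Enum EB

  Matrix : Set
  Matrix = A → B → ℕ

  row : Matrix → A → ℕ
  row Y a = EB.total (Y a)

  col : Matrix → B → ℕ
  col Y b = EA.total (λ a → Y a b)

  unit : A → B → Matrix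
  unit a b x y = EA.δ x a * EB.δ y b

  row-unit : ∀ a b x → row (unit a b) x ≡ EA.δ x a
  row-unit a b x = begin
    row (unit a b) x                    ≡⟨ ∑-*ˡ EB.elems (EA.δ x a) _ ⟩
    EA.δ x a * EB.total (λ y → EB.δ y b) ≡⟨ cong (EA.δ x a *_) (EB.once b) ⟩
    EA.δ x a * 1                        ≡⟨ *-identityʳ _ ⟩
    EA.δ x a                            ∎
    where open ≡-Reasoning

  col-unit : ∀ a b y → col (unit a b) y ≡ EB.δ y b
  col-unit a b y = begin
    col (unit a b) y                    ≡⟨ ∑-*ʳ EA.elems (EB.δ y b) _ ⟩
    EA.total (λ x → EA.δ x a) * EB.δ y b ≡⟨ cong (_* EB.δ y b) (EA.once a) ⟩
    1 * EB.δ y b                        ≡⟨ *-identityˡ _ ⟩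
    EB.δ y b                            ∎
    where open ≡-Reasoning

  _⊕_ : Matrix → Matrix → Matrix
  (Y ⊕ Z) x y = Y x y + Z x y

  row-⊕ : ∀ Y Z a → row (Y ⊕ Z) a ≡ row Y a + row Z a
  row-⊕ Y Z a = ∑-+ EB.elems (Y a) (Z a)

  col-⊕ : ∀ Y Z b → col (Y ⊕ Z) b ≡ col Y b + col Z b
  col-⊕ Y Z b = ∑-+ EA.elems (λ a → Y a b) (λ a → Z a b)

  add-unit-≤ : ∀ {Y : Matrix} {a b} → (∀ x y → Y x y ≤ cap x y) → Y a b < cap a b →
               ∀ x y → Y x y + unit a b x y ≤ cap x y
  add-unit-≤ {Y} {a} {b} Y≤ lt x y with x EA.≟ₑ a | y EB.≟ₑ b
  ... | yes refl | yes refl = subst (_≤ cap x y) (+-comm 1 (Y x y)) lt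
  ... | yes refl | no _     = subst (_≤ cap x y) (sym (+-identityʳ _)) (Y≤ x y)
  ... | no _     | _        = subst (_≤ cap x y) (sym (+-identityʳ _)) (Y≤ x y)

  -- Alternating search from the deficient row `s`: an explored row with a cell below capacity leads
  -- to that column, and an explored column leads to every row with a positive entry in it. Reaching
  -- a column below `C` gives an augmenting path; otherwise the explored part is a cut.
  module Augment (Y : Matrix) (Y≤cap : ∀ a b → Y a b ≤ cap a b)
    (col≤ : ∀ b → col Y b ≤ C b) (row≤ : ∀ a → row Y a ≤ R a)
    (s : A) (deficit : row Y s < R s) where

    Augmented : Set
    Augmented = ∃[ Y' ] (∀ a b → Y' a b ≤ cap a b) × (∀ b → col Y' b ≤ C b)
                        × (∀ a → row Y' a ≡ row Y a + EA.δ a s)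

    -- A feasible matrix whose missing unit has been moved from row s to row a.
    record Shifted (Z : B → Bool) (a : A) : Set where
      field
        mat     : Matrix
        mat≤cap : ∀ x y → mat x y ≤ cap x y
        mat-col : ∀ y → col mat y ≡ col Y y
        mat-row : ∀ x → row mat x + EA.δ x a ≡ row Y x + EA.δ x s
        -- Shifts touch explored columns only, so a cell of an unexplored column that is free in `Y`
        -- is still free in `mat`.
        mat-off : ∀ x y → Z y ≡ false → mat x y ≡ Y x y

    record Explored (X : A → Bool) (Z : B → Bool) : Set where
      field
        start     : X s ≡ true
        shifted   : ∀ a → X a ≡ true → Shifted Z a
        closed    : ∀ a b → Z b ≡ true → 0 < Y a b → X a ≡ true
        saturated : ∀ b → Z b ≡ true → col Y b ≡ C b

    -- If no edge leaves the explored part, its cut contradicts the existence of F.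
    stuck : ∀ {X Z} → Explored X Z →
            (∀ a b → X a ≡ true → Z b ≡ false → Y a b ≡ cap a b) → Augmented
    stuck {X} {Z} ex full = contradiction strict (≤⇒≯ (*-cancelˡ-≤ p below))
      where
      open Explored ex
      strict : EA.total (λ a → ⟦ X a ⟧ * row Y a) < EA.total (λ a → ⟦ X a ⟧ * R a)
      strict = EA.total-mono-< (λ a → *-monoʳ-≤ ⟦ X a ⟧ (row≤ a)) s
                 (subst (λ x → ⟦ x ⟧ * row Y s < ⟦ x ⟧ * R s) (sym start)
                   (subst₂ _<_ (sym (*-identityˡ _)) (sym (*-identityˡ _)) deficit))
      exchange : ∀ G → EA.total (λ a → ⟦ X a ⟧ * row G a)
                     ≡ EB.total (λ b → EA.total (λ a → ⟦ X a ⟧ * G a b))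
      exchange G = trans (∑-cong EA.elems λ a → sym (∑-*ˡ EB.elems ⟦ X a ⟧ (G a)))
                         (∑-swap EA.elems EB.elems λ a b → ⟦ X a ⟧ * G a b)
      swap-* : ∀ x y z → x * (y * z) ≡ y * (x * z)
      swap-* = solve-∀
      -- In an unexplored column the explored rows are at capacity, which bounds `F`. In an explored
      -- column they carry all of `Y`, hence the full sum `C b`, and `F` has no more than `p` times
      -- that to offer.
      column : ∀ b → EA.total (λ a → ⟦ X a ⟧ * F a b) ≤ p * EA.total (λ a → ⟦ X a ⟧ * Y a b)
      column b with Z b in zb
      ... | false = subst (EA.total (λ a → ⟦ X a ⟧ * F a b) ≤_)
                      (∑-*ˡ EA.elems p _) (∑-mono EA.elems term)
        where
        term : ∀ a → ⟦ X a ⟧ * F a b ≤ p * (⟦ X a ⟧ * Y a b)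
        term a with X a in xa
        ... | false = z≤n
        ... | true  = subst₂ _≤_ (sym (*-identityˡ _))
                        (trans (cong (p *_) (sym (full a b xa zb))) (cong (p *_) (sym (*-identityˡ _))))
                        (F≤cap a b)
      ... | true = begin
        EA.total (λ a → ⟦ X a ⟧ * F a b)  ≤⟨ ∑-mono EA.elems drop ⟩
        EA.total (λ a → F a b)            ≡⟨ F-col b ⟩
        p * C b                           ≡⟨ cong (p *_) (sym (saturated b zb)) ⟩
        p * col Y b                       ≡⟨ cong (p *_) (∑-cong EA.elems keep) ⟩
        p * EA.total (λ a → ⟦ X a ⟧ * Y a b) ∎
        where
        open ≤-Reasoning
        drop : ∀ a → ⟦ X a ⟧ * F a b ≤ F a b
        drop a with X a
        ... | false = z≤n
        ... | true  = ≤-reflexive (*-identityˡ _)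
        keep : ∀ a → Y a b ≡ ⟦ X a ⟧ * Y a b
        keep a with X a in xa | Y a b in yab
        ... | true  | _     = sym (*-identityˡ _)
        ... | false | zero  = refl
        ... | false | suc _ = contradiction
              (trans (sym xa) (closed a b zb (subst (0 <_) (sym yab) z<s))) λ ()
      below : p * EA.total (λ a → ⟦ X a ⟧ * R a) ≤ p * EA.total (λ a → ⟦ X a ⟧ * row Y a)
      below = begin
        p * EA.total (λ a → ⟦ X a ⟧ * R a)    ≡⟨ sym (∑-*ˡ EA.elems p _) ⟩
        EA.total (λ a → p * (⟦ X a ⟧ * R a))  ≡⟨ ∑-cong EA.elems (λ a →
                                                   trans (swap-* p ⟦ X a ⟧ (R a))
                                                         (cong (⟦ X a ⟧ *_) (sym (F-row a)))) ⟩
        EA.total (λ a → ⟦ X a ⟧ * row F a)    ≡⟨ exchange F ⟩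
        EB.total (λ b → EA.total (λ a → ⟦ X a ⟧ * F a b)) ≤⟨ ∑-mono EB.elems column ⟩
        EB.total (λ b → p * EA.total (λ a → ⟦ X a ⟧ * Y a b)) ≡⟨ ∑-*ˡ EB.elems p _ ⟩
        p * EB.total (λ b → EA.total (λ a → ⟦ X a ⟧ * Y a b)) ≡⟨ cong (p *_) (sym (exchange Y)) ⟩
        p * EA.total (λ a → ⟦ X a ⟧ * row Y a) ∎
        where open ≤-Reasoning

    finish : ∀ {Z a b} → Shifted Z a → Z b ≡ false → Y a b < cap a b → col Y b < C b → Augmented
    finish {Z} {a} {b} sh zb lt short =
      mat ⊕ unit a b
      , add-unit-≤ mat≤cap (subst (_< cap a b) (sym (mat-off a b zb)) lt)
      , cols
      , λ x → trans (row-⊕ mat (unit a b) x) (trans (cong (row mat x +_) (row-unit a b x)) (mat-row x))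
      where
      open Shifted sh
      cols : ∀ y → col (mat ⊕ unit a b) y ≤ C y
      cols y rewrite col-⊕ mat (unit a b) y | col-unit a b y | mat-col y with y EB.≟ₑ b
      ... | yes refl = subst (_≤ C y) (+-comm 1 (col Y y)) short
      ... | no _     = subst (_≤ C y) (sym (+-identityʳ _)) (col≤ y)

    -- Row `a` gains a unit in column `b` and row `a'` gives one up there: the column sum is
    -- unchanged and the missing unit now belongs to `a'`.
    reroute : ∀ {Z a b} a' → a' ≢ a → Shifted Z a → Z b ≡ false → Y a b < cap a b → 0 < Y a' b →
              Shifted (λ y → Z y ∨ does (y EB.≟ₑ b)) a'
    reroute {Z} {a} {b} a' a'≢a sh zb lt pos = record
      { mat = mat'
      ; mat≤cap = λ x y → ≤-trans (m∸n≤m _ (unit a' b x y))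
                    (add-unit-≤ mat≤cap (subst (_< cap a b) (sym (mat-off a b zb)) lt) x y)
      ; mat-col = λ y → +-cancelʳ-≡ (EB.δ y b) _ _ (cols y)
      ; mat-row = rows
      ; mat-off = off
      }
      where
      open Shifted sh
      mat' : Matrix
      mat' x y = (mat x y + unit a b x y) ∸ unit a' b x y
      unit-≤ : ∀ x y → unit a' b x y ≤ mat x y + unit a b x y
      unit-≤ x y with x EA.≟ₑ a' | y EB.≟ₑ b
      ... | no _     | _        = z≤n
      ... | yes refl | no _     = z≤n
      ... | yes refl | yes refl = ≤-trans (subst (1 ≤_) (sym (mat-off x y zb)) pos) (m≤m+n _ _)
      restore : ∀ x y → mat' x y + unit a' b x y ≡ mat x y + unit a b x y
      restore x y = m∸n+n≡m (unit-≤ x y)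
      cols : ∀ y → col mat' y + EB.δ y b ≡ col Y y + EB.δ y b
      cols y = begin
        col mat' y + EB.δ y b          ≡⟨ cong (col mat' y +_) (sym (col-unit a' b y)) ⟩
        col mat' y + col (unit a' b) y ≡⟨ sym (col-⊕ mat' (unit a' b) y) ⟩
        col (mat' ⊕ unit a' b) y       ≡⟨ ∑-cong EA.elems (λ x → restore x y) ⟩
        col (mat ⊕ unit a b) y         ≡⟨ col-⊕ mat (unit a b) y ⟩
        col mat y + col (unit a b) y   ≡⟨ cong₂ _+_ (mat-col y) (col-unit a b y) ⟩
        col Y y + EB.δ y b             ∎
        where open ≡-Reasoning
      rows : ∀ x → row mat' x + EA.δ x a' ≡ row Y x + EA.δ x s
      rows x = begin
        row mat' x + EA.δ x a'         ≡⟨ cong (row mat' x +_) (sym (row-unit a' b x)) ⟩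
        row mat' x + row (unit a' b) x ≡⟨ sym (row-⊕ mat' (unit a' b) x) ⟩
        row (mat' ⊕ unit a' b) x       ≡⟨ ∑-cong EB.elems (restore x) ⟩
        row (mat ⊕ unit a b) x         ≡⟨ row-⊕ mat (unit a b) x ⟩
        row mat x + row (unit a b) x   ≡⟨ cong (row mat x +_) (row-unit a b x) ⟩
        row mat x + EA.δ x a           ≡⟨ mat-row x ⟩
        row Y x + EA.δ x s             ∎
        where open ≡-Reasoning
      off : ∀ x y → Z y ∨ does (y EB.≟ₑ b) ≡ false → mat' x y ≡ Y x y
      off x y h with Z y in zy | y EB.≟ₑ b
      off x y () | true  | _
      off x y () | false | yes _
      off x y h  | false | no y≢b
        rewrite *-zeroʳ (EA.δ x a) | *-zeroʳ (EA.δ x a') = trans (+-identityʳ _) (mat-off x y zy)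

    unexplored : (B → Bool) → ℕ
    unexplored Z = EB.total λ b → ⟦ not (Z b) ⟧

    -- A saturated column cannot absorb the unit, but each row with a positive entry in it can pass
    -- one on, so all these rows become explored together with the column.
    extend : ∀ {X Z a b} → Explored X Z → X a ≡ true → Z b ≡ false → Y a b < cap a b →
             col Y b ≡ C b →
             Explored (λ x → X x ∨ (0 <ᵇ Y x b)) (λ y → Z y ∨ does (y EB.≟ₑ b))
    extend {X} {Z} {a} {b} ex xa zb lt sat = record
      { start = cong (_∨ (0 <ᵇ Y s b)) start
      ; shifted = shifted'
      ; closed = closed'
      ; saturated = saturated'
      }
      where
      open Explored ex
      weaken : ∀ {x} → Shifted Z x → Shifted (λ y → Z y ∨ does (y EB.≟ₑ b)) x
      weaken sh = record
        { mat = mat ; mat≤cap = mat≤cap ; mat-col = mat-col ; mat-row = mat-row ; mat-off = off }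
        where
        open Shifted sh
        off : ∀ x y → Z y ∨ does (y EB.≟ₑ b) ≡ false → mat x y ≡ Y x y
        off x y h with Z y in zy
        ... | false = mat-off x y zy
      shifted' : ∀ x → X x ∨ (0 <ᵇ Y x b) ≡ true → Shifted (λ y → Z y ∨ does (y EB.≟ₑ b)) x
      shifted' x h with X x in xx | Y x b in yxb
      ... | true  | _     = weaken (shifted x xx)
      ... | false | suc _ = reroute x x≢a (shifted a xa) zb lt (subst (0 <_) (sym yxb) z<s)
        where
        x≢a : x ≢ a
        x≢a refl = contradiction (trans (sym xx) xa) λ ()
      closed' : ∀ x y → Z y ∨ does (y EB.≟ₑ b) ≡ true → 0 < Y x y → X x ∨ (0 <ᵇ Y x b) ≡ true
      closed' x y h pos with Z y in zy | y EB.≟ₑ b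
      ... | true  | _ rewrite closed x y zy pos = refl
      ... | false | yes refl with Y x y | X x
      ...   | suc _ | true  = refl
      ...   | suc _ | false = refl
      saturated' : ∀ y → Z y ∨ does (y EB.≟ₑ b) ≡ true → col Y y ≡ C y
      saturated' y h with Z y in zy | y EB.≟ₑ b
      ... | true  | _        = saturated y zy
      ... | false | yes refl = sat

    fewer : ∀ Z {b} → Z b ≡ false → unexplored (λ y → Z y ∨ does (y EB.≟ₑ b)) < unexplored Z
    fewer Z {b} zb = EB.total-mono-< le b lt
      where
      le : ∀ y → ⟦ not (Z y ∨ does (y EB.≟ₑ b)) ⟧ ≤ ⟦ not (Z y) ⟧
      le y with Z y | does (y EB.≟ₑ b)
      ... | true  | _     = z≤n
      ... | false | true  = z≤n
      ... | false | false = ≤-refl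
      lt : ⟦ not (Z b ∨ does (b EB.≟ₑ b)) ⟧ < ⟦ not (Z b) ⟧
      lt rewrite zb | dec-true (b EB.≟ₑ b) refl = z<s

    leaving : (A → Bool) → (B → Bool) → A → B → ℕ
    leaving X Z a b = ⟦ X a ∧ not (Z b) ⟧ * (cap a b ∸ Y a b)

    room : ∀ {a b} → 0 < 1 * (cap a b ∸ Y a b) → Y a b < cap a b
    room pos = 0<n∸m⇒m<n (subst (0 <_) (*-identityˡ _) pos)

    -- Every round that does not finish adds a column to `Z`, so the number of unexplored columns
    -- bounds the recursion.
    explore : ∀ fuel {X Z} → unexplored Z ≤ fuel → Explored X Z → Augmented
    explore fuel {X} {Z} le ex with EA.search (λ a → EB.total (leaving X Z a))
    ... | inj₂ none = stuck ex full
      where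
      full : ∀ a b → X a ≡ true → Z b ≡ false → Y a b ≡ cap a b
      full a b xa zb = ≤-antisym (Y≤cap a b) (m∸n≡0⇒m≤n vanish)
        where
        vanish : cap a b ∸ Y a b ≡ 0
        vanish = trans (trans (sym (*-identityˡ _))
                   (cong₂ (λ x z → ⟦ x ∧ not z ⟧ * (cap a b ∸ Y a b)) (sym xa) (sym zb)))
                   (n≤0⇒n≡0 (subst (leaving X Z a b ≤_) (none a) (EB.term≤total (leaving X Z a) b)))
    ... | inj₁ (a , pos) with ∑-positive EB.elems _ pos
    ... | b , pos' with X a in xa | Z b in zb
    ... | true | false with col Y b <? C b
    ...   | yes short = finish (Explored.shifted ex a xa) zb (room pos') short
    ...   | no full with fuel
    ...     | zero  = contradiction (n≤0⇒n≡0 le) (m<n⇒n≢0 (fewer Z zb))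
    ...     | suc f = explore f (≤-pred (≤-trans (fewer Z zb) le))
                        (extend ex xa zb (room pos') (≤-antisym (col≤ b) (≮⇒≥ full)))

    augment : Augmented
    augment = explore (unexplored λ _ → false) {λ a → does (a EA.≟ₑ s)} {λ _ → false} ≤-refl record
      { start = dec-true (s EA.≟ₑ s) refl
      ; shifted = initial
      ; closed = λ _ _ ()
      ; saturated = λ _ ()
      }
      where
      initial : ∀ a → does (a EA.≟ₑ s) ≡ true → Shifted (λ _ → false) a
      initial a h with a EA.≟ₑ s
      ... | yes refl = record
        { mat = Y ; mat≤cap = Y≤cap ; mat-col = λ _ → refl ; mat-row = λ _ → refl
        ; mat-off = λ _ _ _ → refl }

  Rounded : Set
  Rounded = ∃[ Y ] (∀ a b → Y a b ≤ cap a b) × (∀ a → row Y a ≡ R a) × (∀ b → col Y b ≡ C b)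

  -- Only the rows are driven to equality, one unit of deficit per round; columns merely stay below
  -- `C`. At the end the grand totals of `R` and `C` agree because both are that of `F` divided by
  -- `p`, and this forces equality in every column.
  grow : ∀ fuel (Y : Matrix) → (∀ a b → Y a b ≤ cap a b) → (∀ b → col Y b ≤ C b) →
         (∀ a → row Y a ≤ R a) → EA.total (λ a → R a ∸ row Y a) ≤ fuel → Rounded
  grow fuel Y Y≤ col≤ row≤ le with EA.search (λ a → R a ∸ row Y a)
  ... | inj₂ none = Y , Y≤ , rows , EB.total-tight col≤ sums
    where
    rows : ∀ a → row Y a ≡ R a
    rows a = ≤-antisym (row≤ a) (m∸n≡0⇒m≤n (none a))
    sums : EB.total (col Y) ≡ EB.total C
    sums = *-cancelˡ-≡ _ _ p (begin
      p * EB.total (col Y)                   ≡⟨ cong (p *_) (sym (∑-swap EA.elems EB.elems Y)) ⟩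
      p * EA.total (row Y)                   ≡⟨ cong (p *_) (∑-cong EA.elems rows) ⟩
      p * EA.total R                         ≡⟨ sym (∑-*ˡ EA.elems p R) ⟩
      EA.total (λ a → p * R a)               ≡⟨ ∑-cong EA.elems (λ a → sym (F-row a)) ⟩
      EA.total (row F)                       ≡⟨ ∑-swap EA.elems EB.elems F ⟩
      EB.total (col F)                       ≡⟨ ∑-cong EB.elems F-col ⟩
      EB.total (λ b → p * C b)               ≡⟨ ∑-*ˡ EB.elems p C ⟩
      p * EB.total C                         ∎)
      where open ≡-Reasoning
  ... | inj₁ (s , pos) with Augment.augment Y Y≤ col≤ row≤ s (0<n∸m⇒m<n pos)
  ... | Y' , Y'≤ , col'≤ , rows with fuel
  ...   | zero  = contradiction (n≤0⇒n≡0 (≤-trans (EA.term≤total (λ a → R a ∸ row Y a) s) le)) (m<n⇒n≢0 pos)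
  ...   | suc f = grow f Y' Y'≤ col'≤ row'≤ (≤-pred (≤-trans smaller le))
    where
    deficit : row Y s < R s
    deficit = 0<n∸m⇒m<n pos
    row'≤ : ∀ a → row Y' a ≤ R a
    row'≤ a rewrite rows a with a EA.≟ₑ s
    ... | yes refl = subst (_≤ R a) (+-comm 1 (row Y a)) deficit
    ... | no _     = subst (_≤ R a) (sym (+-identityʳ _)) (row≤ a)
    smaller : EA.total (λ a → R a ∸ row Y' a) < EA.total (λ a → R a ∸ row Y a)
    smaller = EA.total-mono-<
      (λ a → ∸-monoʳ-≤ (R a) (subst (row Y a ≤_) (sym (rows a)) (m≤m+n _ _))) s
      (∸-monoʳ-< (subst (row Y s <_) (sym (trans (rows s) (cong (row Y s +_) (EA.δ-refl s))))
                    (subst (row Y s <_) (+-comm 1 (row Y s)) ≤-refl)) (row'≤ s))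

  rounding : Rounded
  rounding = grow (EA.total (λ a → R a ∸ row (λ _ _ → 0) a)) (λ _ _ → 0)
    (λ _ _ → z≤n) (λ b → subst (_≤ C b) (sym (∑-0 EA.elems)) z≤n)
    (λ a → subst (_≤ R a) (sym (∑-0 EB.elems)) z≤n) ≤-refl

-- Enumerations of `Fin k` and of vertex sets

∑-tabulate : ∀ {n} (g : Fin n → A) (f : A → ℕ) → ∑ (tabulate g) f ≡ sumFin (f ∘ g)
∑-tabulate {n = zero}  g f = refl
∑-tabulate {n = suc n} g f = cong (f (g Fin.zero) +_) (∑-tabulate (g ∘ Fin.suc) f)

sumFin-cong : ∀ {n} {f g : Fin n → ℕ} → (∀ i → f i ≡ g i) → sumFin f ≡ sumFin g
sumFin-cong {zero}  h = refl
sumFin-cong {suc n} h = cong₂ _+_ (h Fin.zero) (sumFin-cong (h ∘ Fin.suc))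

sumFin-0 : ∀ n → sumFin {n} (λ _ → 0) ≡ 0
sumFin-0 zero    = refl
sumFin-0 (suc n) = sumFin-0 n

finEnum : ∀ k → Enum (Fin k)
finEnum k = record
  { elems = allFin k
  ; _≟ₑ_  = Fin._≟_
  ; once  = λ a → trans (∑-tabulate id (λ x → ⟦ does (x Fin.≟ a) ⟧)) (sumFin-once a)
  }
  where
  sumFin-once : ∀ {n} (a : Fin n) → sumFin (λ x → ⟦ does (x Fin.≟ a) ⟧) ≡ 1
  sumFin-once {suc n} Fin.zero    = cong suc (sumFin-0 n)
  sumFin-once {suc n} (Fin.suc a) = sumFin-once a

subsets : ∀ n → List (Vec Bool n)
subsets zero    = [] ∷ []
subsets (suc n) = map (false ∷_) (subsets n) ++ map (true ∷_) (subsets n)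

∑-subsets-suc : ∀ n f → ∑ (subsets (suc n)) f ≡
  ∑ (subsets n) (λ S → f (false ∷ S)) + ∑ (subsets n) (λ S → f (true ∷ S))
∑-subsets-suc n f = trans (∑-++ (map (false ∷_) (subsets n)) _ f)
  (cong₂ _+_ (∑-map (false ∷_) (subsets n) f) (∑-map (true ∷_) (subsets n) f))

subsetEnum : ∀ n → Enum (Vec Bool n)
subsetEnum n = record { elems = subsets n ; _≟ₑ_ = Vec-≡-dec Bool._≟_ ; once = subsets-once }
  where
  subsets-once : ∀ {n} (S : Vec Bool n) →
                 ∑ (subsets n) (λ T → ⟦ does (Vec-≡-dec Bool._≟_ T S) ⟧) ≡ 1
  subsets-once [] = refl
  subsets-once {suc n} (false ∷ S) = trans (∑-subsets-suc n _)
    (trans (cong₂ _+_ (subsets-once S) (∑-0 (subsets n))) refl)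
  subsets-once {suc n} (true ∷ S) = trans (∑-subsets-suc n _)
    (cong₂ _+_ (∑-0 (subsets n)) (subsets-once S))

size : ∀ {n} → Vec Bool n → ℕ
size []      = 0
size (b ∷ S) = ⟦ b ⟧ + size S

-- The head of S : Vec Bool (suc n) records whether the vertex n belongs to S.
mem : ∀ {n} → Vec Bool n → ℕ → Bool
mem [] v = false
mem {suc n} (b ∷ S) v = if does (v ≟ n) then b else mem S v

mem-last : ∀ {n} b (S : Vec Bool n) → mem (b ∷ S) n ≡ b
mem-last {n} b S rewrite dec-true (n ≟ n) refl = refl

mem-init : ∀ {n v} b (S : Vec Bool n) → v < n → mem (b ∷ S) v ≡ mem S v
mem-init {n} {v} b S v<n rewrite dec-false (v ≟ n) (<⇒≢ v<n) = refl

∑-cong-All : ∀ {P : A → Set} {xs f g} → All P xs → (∀ x → P x → f x ≡ g x) → ∑ xs f ≡ ∑ xs g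
∑-cong-All [] h = refl
∑-cong-All (px ∷ pxs) h = cong₂ _+_ (h _ px) (∑-cong-All pxs h)

downFrom-< : ∀ n → All (_< n) (downFrom n)
downFrom-< zero    = []
downFrom-< (suc n) = ≤-refl ∷ All.map m<n⇒m<1+n (downFrom-< n)

∑-cong-< : ∀ n {f g} → (∀ i → i < n → f i ≡ g i) → ∑ (downFrom n) f ≡ ∑ (downFrom n) g
∑-cong-< n h = ∑-cong-All (downFrom-< n) h

∑-mem : ∀ {n} (S : Vec Bool n) → ∑ (downFrom n) (λ v → ⟦ mem S v ⟧) ≡ size S
∑-mem [] = refl
∑-mem {suc n} (b ∷ S) = cong₂ _+_ (cong ⟦_⟧ (mem-last b S))
  (trans (∑-cong-< n λ v v<n → cong ⟦_⟧ (mem-init b S v<n)) (∑-mem S))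

∑-downFrom-suc : ∀ n f → ∑ (downFrom (suc n)) f ≡ f 0 + ∑ (downFrom n) (f ∘ suc)
∑-downFrom-suc zero f = refl
∑-downFrom-suc (suc n) f = begin
  f (suc n) + ∑ (downFrom (suc n)) f              ≡⟨ cong (f (suc n) +_) (∑-downFrom-suc n f) ⟩
  f (suc n) + (f 0 + ∑ (downFrom n) (f ∘ suc))    ≡⟨ x+[y+z]≡y+[x+z] (f (suc n)) (f 0) _ ⟩
  f 0 + (f (suc n) + ∑ (downFrom n) (f ∘ suc))    ∎
  where
  open ≡-Reasoning
  x+[y+z]≡y+[x+z] : ∀ x y z → x + (y + z) ≡ y + (x + z)
  x+[y+z]≡y+[x+z] = solve-∀

sumFin-toℕ : ∀ n f → sumFin {n} (f ∘ toℕ) ≡ ∑ (downFrom n) f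
sumFin-toℕ zero f = refl
sumFin-toℕ (suc n) f = trans (cong (f 0 +_) (sumFin-toℕ n (f ∘ suc))) (sym (∑-downFrom-suc n f))

∑-downFrom-δ : ∀ {n a} (f : ℕ → ℕ) → a < n → ∑ (downFrom n) (λ v → ⟦ does (v ≟ a) ⟧ * f v) ≡ f a
∑-downFrom-δ {suc n} {a} f a<1+n with m<1+n⇒m<n∨m≡n a<1+n
... | inj₁ a<n rewrite dec-false (n ≟ a) (≢-sym (<⇒≢ a<n)) = ∑-downFrom-δ f a<n
... | inj₂ refl rewrite dec-true (a ≟ a) refl = begin
  (f a + 0) + ∑ (downFrom a) (λ v → ⟦ does (v ≟ a) ⟧ * f v)
    ≡⟨ cong₂ _+_ (+-identityʳ _) (∑-cong-< a λ v v<a →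
         cong (λ b → ⟦ b ⟧ * f v) (dec-false (v ≟ a) (<⇒≢ v<a))) ⟩
  f a + ∑ (downFrom a) (λ _ → 0)
    ≡⟨ cong (f a +_) (∑-0 (downFrom a)) ⟩
  f a + 0
    ≡⟨ +-identityʳ _ ⟩
  f a ∎
  where open ≡-Reasoning

elem : ℕ → List ℕ → Bool
elem v []       = false
elem v (x ∷ xs) = does (v ≟ x) ∨ elem v xs

-- Entries outside the range are dropped, so a single list names the same hyperedge in every ground
-- set that contains it. This is how hyperedges are compared before and after vertices are split
-- off.
setOf : ∀ n → List ℕ → Vec Bool n
setOf zero    xs = []
setOf (suc n) xs = elem n xs ∷ setOf n xs

mem-setOf : ∀ {n v} xs → v < n → mem (setOf n xs) v ≡ elem v xs
mem-setOf {suc n} {v} xs v<1+n with m<1+n⇒m<n∨m≡n v<1+n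
... | inj₁ v<n = trans (mem-init (elem n xs) (setOf n xs) v<n) (mem-setOf xs v<n)
... | inj₂ refl = mem-last (elem n xs) (setOf n xs)

setOf-drop : ∀ {n x} xs → n ≤ x → setOf n (x ∷ xs) ≡ setOf n xs
setOf-drop {zero} xs n≤x = refl
setOf-drop {suc n} {x} xs n<x rewrite dec-false (n ≟ x) (<⇒≢ n<x) =
  cong (_ ∷_) (setOf-drop xs (<⇒≤ n<x))

elem-> : ∀ {n xs} → All (_< n) xs → elem n xs ≡ false
elem-> [] = refl
elem-> {n} {x ∷ xs} (x<n ∷ xs<n) rewrite dec-false (n ≟ x) (≢-sym (<⇒≢ x<n)) = elem-> xs<n

setOf-pad : ∀ {n xs} → All (_< n) xs → setOf (suc n) xs ≡ false ∷ setOf n xs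
setOf-pad {n} {xs} xs<n = cong (_∷ setOf n xs) (elem-> xs<n)

setOf-snoc : ∀ n xs → setOf (suc n) (n ∷ xs) ≡ true ∷ setOf n xs
setOf-snoc n xs rewrite dec-true (n ≟ n) refl = cong (true ∷_) (setOf-drop xs ≤-refl)

size-setOf : ∀ {n d xs} → d < n → All (_< d) xs → size (setOf n (d ∷ xs)) ≡ suc (size (setOf d xs))
size-setOf {suc n} {d} {xs} d<1+n xs<d with m<1+n⇒m<n∨m≡n d<1+n
... | inj₁ d<n = trans (cong size (setOf-pad (d<n ∷ All.map (λ x<d → <-trans x<d d<n) xs<d)))
                       (size-setOf d<n xs<d)
... | inj₂ refl = cong size (setOf-snoc d xs)

size-setOf-[] : ∀ n → size (setOf n []) ≡ 0
size-setOf-[] zero    = refl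
size-setOf-[] (suc n) = size-setOf-[] n

size-triple : ∀ {n a b d} → a < b → b < d → d < n → size (setOf n (d ∷ b ∷ a ∷ [])) ≡ 3
size-triple {a = a} a<b b<d d<n =
  trans (size-setOf d<n (b<d ∷ <-trans a<b b<d ∷ []))
    (cong suc (trans (size-setOf b<d (a<b ∷ []))
      (cong suc (trans (size-setOf a<b []) (cong suc (size-setOf-[] a))))))

-- The s-element subsets of {0, …, n-1}, listed decreasingly.
chains : ℕ → ℕ → List (List ℕ)
chains zero    n       = [] ∷ []
chains (suc s) zero    = []
chains (suc s) (suc n) = map (n ∷_) (chains s n) ++ chains (suc s) n

chains-< : ∀ s n → All (All (_< n)) (chains s n)
chains-< zero    n       = [] ∷ []
chains-< (suc s) zero    = []
chains-< (suc s) (suc n) = All.++⁺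
  (All.map⁺ (All.map (λ xs<n → ≤-refl ∷ All.map m<n⇒m<1+n xs<n) (chains-< s n)))
  (All.map (All.map m<n⇒m<1+n) (chains-< (suc s) n))

∑-chains-suc : ∀ s n F → ∑ (chains (suc s) n) F ≡ ∑ (downFrom n) (λ d → ∑ (chains s d) (λ xs → F (d ∷ xs)))
∑-chains-suc s zero F = refl
∑-chains-suc s (suc n) F = trans (∑-++ (map (n ∷_) (chains s n)) _ F)
  (cong₂ _+_ (∑-map (n ∷_) (chains s n) F) (∑-chains-suc s n F))

-- Both listings branch on whether the largest vertex is taken, only in opposite order. The lemma
-- turns nested sums over increasing vertices into sums over characteristic vectors.
∑-chains : ∀ s n F →
  ∑ (chains s n) (λ xs → F (setOf n xs)) ≡ ∑ (subsets n) (λ S → ⟦ does (size S ≟ s) ⟧ * F S)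
∑-chains zero zero F = cong (_+ 0) (sym (*-identityˡ _))
∑-chains (suc s) zero F = refl
∑-chains zero (suc n) F = begin
  F (false ∷ setOf n []) + 0
    ≡⟨ ∑-chains zero n (λ S → F (false ∷ S)) ⟩
  ∑ (subsets n) (λ S → ⟦ does (size S ≟ 0) ⟧ * F (false ∷ S))
    ≡⟨ sym (x+0 (∑-0 (subsets n))) ⟩
  ∑ (subsets n) (λ S → ⟦ does (size S ≟ 0) ⟧ * F (false ∷ S)) + ∑ (subsets n) (λ _ → 0)
    ≡⟨ sym (∑-subsets-suc n _) ⟩
  ∑ (subsets (suc n)) (λ S → ⟦ does (size S ≟ 0) ⟧ * F S) ∎
  where
  open ≡-Reasoning
  x+0 : ∀ {x y} → y ≡ 0 → x + y ≡ x
  x+0 refl = +-identityʳ _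
∑-chains (suc s) (suc n) F = begin
  ∑ (map (n ∷_) (chains s n) ++ chains (suc s) n) F'
    ≡⟨ ∑-++ (map (n ∷_) (chains s n)) _ F' ⟩
  ∑ (map (n ∷_) (chains s n)) F' + ∑ (chains (suc s) n) F'
    ≡⟨ cong₂ _+_
         (trans (∑-map (n ∷_) (chains s n) F') (∑-cong (chains s n) λ xs → cong F (setOf-snoc n xs)))
         (∑-cong-All (chains-< (suc s) n) λ xs xs<n → cong F (setOf-pad xs<n)) ⟩
  ∑ (chains s n) (λ xs → F (true ∷ setOf n xs)) + ∑ (chains (suc s) n) (λ xs → F (false ∷ setOf n xs))
    ≡⟨ cong₂ _+_ (∑-chains s n (λ S → F (true ∷ S))) (∑-chains (suc s) n (λ S → F (false ∷ S))) ⟩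
  ∑ (subsets n) (λ S → ⟦ does (size S ≟ s) ⟧ * F (true ∷ S))
    + ∑ (subsets n) (λ S → ⟦ does (size S ≟ suc s) ⟧ * F (false ∷ S))
    ≡⟨ +-comm (∑ (subsets n) _) _ ⟩
  ∑ (subsets n) (λ S → ⟦ does (size S ≟ suc s) ⟧ * F (false ∷ S))
    + ∑ (subsets n) (λ S → ⟦ does (size S ≟ s) ⟧ * F (true ∷ S))
    ≡⟨ sym (∑-subsets-suc n _) ⟩
  ∑ (subsets (suc n)) (λ S → ⟦ does (size S ≟ suc s) ⟧ * F S) ∎
  where
  open ≡-Reasoning
  F' = λ xs → F (setOf (suc n) xs)

-- Counting the completions of a vertex set

-- The number of ways to extend an s-element set to a hyperedge by p further vertices.
completions : ℕ → ℕ → ℕ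
completions zero    s = ⟦ does (s ≟ 3) ⟧
completions (suc p) s = completions p s + completions p (suc s)

completions-large : ∀ p {s} → 3 < s → completions p s ≡ 0
completions-large zero {s} 3<s = cong ⟦_⟧ (dec-false (s ≟ 3) (≢-sym (<⇒≢ 3<s)))
completions-large (suc p) 3<s = cong₂ _+_ (completions-large p 3<s) (completions-large p (m<n⇒m<1+n 3<s))

completions-small : ∀ p {s} → p + s < 3 → completions p s ≡ 0
completions-small zero {s} s<3 = cong ⟦_⟧ (dec-false (s ≟ 3) (<⇒≢ s<3))
completions-small (suc p) {s} lt = cong₂ _+_ (completions-small p (<-trans (n<1+n _) lt))
  (completions-small p (subst (_< 3) (sym (+-suc p s)) lt))

completions-3 : ∀ p → completions p 3 ≡ 1
completions-3 zero = refl
completions-3 (suc p) = cong₂ _+_ (completions-3 p) (completions-large p (s≤s ≤-refl))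

completions-2 : ∀ p → completions p 2 ≡ p
completions-2 zero = refl
completions-2 (suc p) = trans (cong₂ _+_ (completions-2 p) (completions-3 p)) (+-comm p 1)

completions-1 : ∀ p → completions p 1 ≡ p C 2
completions-1 zero = refl
completions-1 (suc p) = begin
  completions p 1 + completions p 2 ≡⟨ cong₂ _+_ (completions-1 p) (completions-2 p) ⟩
  p C 2 + p                         ≡⟨ cong (p C 2 +_) (sym (nC1≡n p)) ⟩
  p C 2 + p C 1                     ≡⟨ +-comm (p C 2) _ ⟩
  p C 1 + p C 2                     ≡⟨ nCk+nC[k+1]≡[n+1]C[k+1] p 1 ⟩
  suc p C 2                         ∎
  where open ≡-Reasoning

-- The factor `3 ∸ s` loses exactly one per vertex until truncation sets in at `s = 3`; from there
-- on the identity survives only because `x` vanishes.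
∸-peel : ∀ s x → (3 ≤ s → x ≡ 0) → (3 ∸ s) * x ≡ (3 ∸ suc s) * x + x
∸-peel 0 x h = +-comm x (x + (x + 0))
∸-peel 1 x h = +-comm x (x + 0)
∸-peel 2 x h = +-identityʳ x
∸-peel (suc (suc (suc s))) x h rewrite h (s≤s (s≤s (s≤s z≤n))) | *-zeroʳ (0 ∸ s) = refl

-- Absorption for binomial coefficients, as `completions p s` is `C(p, 3 - s)` for `s <= 3`: count
-- pairs of a completion and one of its added vertices. It makes the row marginals integral when a
-- vertex is split off.
completions-absorb : ∀ p s → (3 ∸ s) * completions (suc p) s ≡ suc p * completions p (suc s)
completions-absorb zero 0 = refl
completions-absorb zero 1 = refl
completions-absorb zero 2 = refl
completions-absorb zero 3 = refl
completions-absorb zero (suc (suc (suc (suc s)))) = refl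
completions-absorb (suc p) s = begin
  (3 ∸ s) * (completions (suc p) s + c)
    ≡⟨ *-distribˡ-+ (3 ∸ s) (completions (suc p) s) c ⟩
  (3 ∸ s) * completions (suc p) s + (3 ∸ s) * c
    ≡⟨ cong₂ _+_ (completions-absorb p s) (∸-peel s c λ 3≤s → completions-large (suc p) (s≤s 3≤s)) ⟩
  suc p * completions p (suc s) + ((3 ∸ suc s) * c + c)
    ≡⟨ cong (λ x → suc p * completions p (suc s) + (x + c)) (completions-absorb p (suc s)) ⟩
  suc p * completions p (suc s) + (suc p * completions p (suc (suc s)) + c)
    ≡⟨ collect p (completions p (suc s)) (completions p (suc (suc s))) ⟩
  suc (suc p) * c ∎
  where
  open ≡-Reasoning
  c = completions (suc p) (suc s)
  collect : ∀ p x y → suc p * x + (suc p * y + (x + y)) ≡ suc (suc p) * (x + y)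
  collect = solve-∀

-- Vandermonde's identity: a completion by `n + p` vertices is sorted by its trace on the first `n`.
-- The induction moves these one at a time into the pool of `p`.
∑-completions : ∀ n p i → ∑ (subsets n) (λ S → completions p (i + size S)) ≡ completions (n + p) i
∑-completions zero p i = trans (+-identityʳ _) (cong (completions p) (+-identityʳ i))
∑-completions (suc n) p i = begin
  ∑ (subsets (suc n)) (λ S → completions p (i + size S))
    ≡⟨ ∑-subsets-suc n _ ⟩
  ∑ (subsets n) (λ S → completions p (i + size S)) + ∑ (subsets n) (λ S → completions p (i + suc (size S)))
    ≡⟨ sym (∑-+ (subsets n) _ _) ⟩
  ∑ (subsets n) (λ S → completions p (i + size S) + completions p (i + suc (size S)))
    ≡⟨ ∑-cong (subsets n) (λ S → cong (λ s → completions p (i + size S) + completions p s) (+-suc i (size S))) ⟩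
  ∑ (subsets n) (λ S → completions (suc p) (i + size S))
    ≡⟨ ∑-completions n (suc p) i ⟩
  completions (n + suc p) i
    ≡⟨ cong (λ x → completions x i) (+-suc n p) ⟩
  completions (suc n + p) i ∎
  where open ≡-Reasoning

-- The same sorting for hyperedges through `v`: one vertex is fixed and the other two come from the
-- remaining `n + p`.
∑-completions-mem : ∀ n p v → v < suc n →
  ∑ (subsets (suc n)) (λ S → ⟦ mem S v ⟧ * completions p (size S)) ≡ completions (n + p) 1
∑-completions-mem n p v v<1+n with m<1+n⇒m<n∨m≡n v<1+n
... | inj₂ refl = begin
  ∑ (subsets (suc n)) (λ S → ⟦ mem S n ⟧ * completions p (size S))
    ≡⟨ ∑-subsets-suc n _ ⟩
  ∑ (subsets n) (λ S → ⟦ mem (false ∷ S) n ⟧ * completions p (size S))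
    + ∑ (subsets n) (λ S → ⟦ mem (true ∷ S) n ⟧ * completions p (suc (size S)))
    ≡⟨ cong₂ _+_
         (trans (∑-cong (subsets n) λ S → cong (λ b → ⟦ b ⟧ * completions p (size S)) (mem-last false S))
                (∑-0 (subsets n)))
         (∑-cong (subsets n) λ S → trans (cong (λ b → ⟦ b ⟧ * completions p (suc (size S))) (mem-last true S))
                                         (*-identityˡ _)) ⟩
  ∑ (subsets n) (λ S → completions p (1 + size S))
    ≡⟨ ∑-completions n p 1 ⟩
  completions (n + p) 1 ∎
  where open ≡-Reasoning
∑-completions-mem (suc n) p v _ | inj₁ v<n = begin
  ∑ (subsets (suc (suc n))) (λ S → ⟦ mem S v ⟧ * completions p (size S))
    ≡⟨ ∑-subsets-suc (suc n) _ ⟩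
  ∑ (subsets (suc n)) (λ S → ⟦ mem (false ∷ S) v ⟧ * completions p (size S))
    + ∑ (subsets (suc n)) (λ S → ⟦ mem (true ∷ S) v ⟧ * completions p (suc (size S)))
    ≡⟨ sym (∑-+ (subsets (suc n)) _ _) ⟩
  ∑ (subsets (suc n)) (λ S → ⟦ mem (false ∷ S) v ⟧ * completions p (size S)
                           + ⟦ mem (true ∷ S) v ⟧ * completions p (suc (size S)))
    ≡⟨ ∑-cong (subsets (suc n)) (λ S → trans
         (cong₂ (λ b c → ⟦ b ⟧ * completions p (size S) + ⟦ c ⟧ * completions p (suc (size S)))
                (mem-init false S v<n) (mem-init true S v<n))
         (sym (*-distribˡ-+ ⟦ mem S v ⟧ _ _))) ⟩
  ∑ (subsets (suc n)) (λ S → ⟦ mem S v ⟧ * completions (suc p) (size S))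
    ≡⟨ ∑-completions-mem n (suc p) v v<n ⟩
  completions (n + suc p) 1
    ≡⟨ cong (λ x → completions x 1) (+-suc n p) ⟩
  completions (suc n + p) 1 ∎
  where open ≡-Reasoning

-- Amalgamated colourings and the detachment of a vertex

-- A colouring of K_{ℓ+p}^3 after the last p vertices have been identified to a single vertex:
-- mult S j counts the hyperedges of colour j that meet the first ℓ vertices exactly in S.
record Amalgam (k r ℓ p : ℕ) : Set where
  field
    mult    : Vec Bool ℓ → Fin k → ℕ
    rows    : ∀ S → ∑ (allFin k) (mult S) ≡ completions p (size S)
    degrees : ∀ v → v < ℓ → ∀ j → ∑ (subsets ℓ) (λ S → ⟦ mem S v ⟧ * mult S j) ≡ r
    -- A hyperedge of type `S` has `3 - |S|` incidences with the merged vertex, which carries the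
    -- degrees of `p` vertices at once.
    weights : ∀ j → ∑ (subsets ℓ) (λ S → (3 ∸ size S) * mult S j) ≡ r * p
open Amalgam public

mult-0 : ∀ {k r ℓ p} (G : Amalgam k r ℓ p) S j → completions p (size S) ≡ 0 → mult G S j ≡ 0
mult-0 {k} G S j e = n≤0⇒n≡0
  (subst (mult G S j ≤_) (trans (rows G S) e) (Enum.term≤total (finEnum k) (mult G S) j))

module Detach {k r ℓ p} (G : Amalgam k r ℓ (suc p)) where

  private
    M = mult G

  m<n∸o⇒m+o<n : ∀ {m n o} → m < n ∸ o → m + o < n
  m<n∸o⇒m+o<n {m} {n} {zero} lt = subst (_< n) (sym (+-identityʳ m)) lt
  m<n∸o⇒m+o<n {m} {suc n} {suc o} lt = subst (_< suc n) (sym (+-suc m o)) (s≤s (m<n∸o⇒m+o<n lt))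

  -- A hyperedge of type `S` needs `3 - |S|` of the `suc p` merged vertices; if there are not that
  -- many, no such hyperedge exists and both sides vanish.
  fraction-≤ : ∀ S j → (3 ∸ size S) * M S j ≤ suc p * M S j
  fraction-≤ S j with 3 ∸ size S ≤? suc p
  ... | yes le = *-monoˡ-≤ (M S j) le
  ... | no ¬le rewrite mult-0 G S j (completions-small (suc p) (m<n∸o⇒m+o<n (≰⇒> ¬le)))
        | *-zeroʳ (3 ∸ size S) = z≤n

  fraction-row : ∀ S → ∑ (allFin k) (λ j → (3 ∸ size S) * M S j) ≡ suc p * completions p (suc (size S))
  fraction-row S = trans (∑-*ˡ (allFin k) (3 ∸ size S) (M S))
    (trans (cong ((3 ∸ size S) *_) (rows G S)) (completions-absorb p (size S)))

  -- The rounded entry at `S`, `j` says how many hyperedges of type `S` and colour `j` pass through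
  -- the detached vertex. Row sums count the hyperedges whose new type is `S` with this vertex
  -- added; column sums are its degree in each colour.
  open Rounding (subsetEnum ℓ) (finEnum k) M (λ S j → (3 ∸ size S) * M S j) (suc p)
    (λ S → completions p (suc (size S))) (λ _ → r) fraction-≤ fraction-row
    (λ j → trans (weights G j) (*-comm r (suc p)))
    using (rounding)

  Y : Vec Bool ℓ → Fin k → ℕ
  Y = proj₁ rounding

  Y≤M : ∀ S j → Y S j ≤ M S j
  Y≤M = proj₁ (proj₂ rounding)

  Y-row : ∀ S → ∑ (allFin k) (Y S) ≡ completions p (suc (size S))
  Y-row = proj₁ (proj₂ (proj₂ rounding))

  Y-col : ∀ j → ∑ (subsets ℓ) (λ S → Y S j) ≡ r
  Y-col = proj₂ (proj₂ (proj₂ rounding))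

  Y-0 : ∀ S j → 3 ≤ size S → Y S j ≡ 0
  Y-0 S j 3≤s = n≤0⇒n≡0 (subst (Y S j ≤_)
    (trans (Y-row S) (completions-large p (s≤s 3≤s))) (Enum.term≤total (finEnum k) (Y S) j))

  M' : Vec Bool (suc ℓ) → Fin k → ℕ
  M' (false ∷ S) j = M S j ∸ Y S j
  M' (true ∷ S)  j = Y S j

  M'-split : ∀ S j → M' (false ∷ S) j + M' (true ∷ S) j ≡ M S j
  M'-split S j = m∸n+n≡m (Y≤M S j)

  M'-rows : ∀ S → ∑ (allFin k) (M' S) ≡ completions p (size S)
  M'-rows (true ∷ S) = Y-row S
  M'-rows (false ∷ S) = +-cancelʳ-≡ (completions p (suc (size S))) _ _ (begin
    ∑ (allFin k) (M' (false ∷ S)) + completions p (suc (size S))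
      ≡⟨ cong (∑ (allFin k) (M' (false ∷ S)) +_) (sym (Y-row S)) ⟩
    ∑ (allFin k) (M' (false ∷ S)) + ∑ (allFin k) (Y S)
      ≡⟨ sym (∑-+ (allFin k) _ _) ⟩
    ∑ (allFin k) (λ j → M' (false ∷ S) j + Y S j)
      ≡⟨ ∑-cong (allFin k) (M'-split S) ⟩
    ∑ (allFin k) (M S)
      ≡⟨ rows G S ⟩
    completions p (size S) + completions p (suc (size S)) ∎)
    where open ≡-Reasoning

  M'-degrees : ∀ v → v < suc ℓ → ∀ j → ∑ (subsets (suc ℓ)) (λ S → ⟦ mem S v ⟧ * M' S j) ≡ r
  M'-degrees v v<1+ℓ j = trans (∑-subsets-suc ℓ _) (trans (sym (∑-+ (subsets ℓ) _ _)) rest)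
    where
    rest : ∑ (subsets ℓ) (λ S → ⟦ mem (false ∷ S) v ⟧ * M' (false ∷ S) j + ⟦ mem (true ∷ S) v ⟧ * Y S j) ≡ r
    rest with m<1+n⇒m<n∨m≡n v<1+ℓ
    ... | inj₁ v<ℓ = trans (∑-cong (subsets ℓ) λ S → trans
            (cong₂ (λ b c → ⟦ b ⟧ * M' (false ∷ S) j + ⟦ c ⟧ * Y S j) (mem-init false S v<ℓ) (mem-init true S v<ℓ))
            (trans (sym (*-distribˡ-+ ⟦ mem S v ⟧ _ _)) (cong (⟦ mem S v ⟧ *_) (M'-split S j))))
          (degrees G v v<ℓ j)
    ... | inj₂ refl = trans (∑-cong (subsets ℓ) λ S → trans
            (cong₂ (λ b c → ⟦ b ⟧ * M' (false ∷ S) j + ⟦ c ⟧ * Y S j) (mem-last false S) (mem-last true S))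
            (*-identityˡ _))
          (Y-col j)

  -- The detached vertex takes `r` incidences per colour away from the merged one, so adding `r`
  -- back must give the old weight.
  M'-weights : ∀ j → ∑ (subsets (suc ℓ)) (λ S → (3 ∸ size S) * M' S j) ≡ r * p
  M'-weights j = +-cancelʳ-≡ r _ _ (begin
    ∑ (subsets (suc ℓ)) (λ S → (3 ∸ size S) * M' S j) + r
      ≡⟨ cong₂ _+_ (trans (∑-subsets-suc ℓ _) (sym (∑-+ (subsets ℓ) _ _))) (sym (Y-col j)) ⟩
    ∑ (subsets ℓ) (λ S → (3 ∸ size S) * M' (false ∷ S) j + (3 ∸ suc (size S)) * Y S j)
      + ∑ (subsets ℓ) (λ S → Y S j)
      ≡⟨ sym (∑-+ (subsets ℓ) _ _) ⟩
    ∑ (subsets ℓ) (λ S → (3 ∸ size S) * M' (false ∷ S) j + (3 ∸ suc (size S)) * Y S j + Y S j)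
      ≡⟨ ∑-cong (subsets ℓ) pointwise ⟩
    ∑ (subsets ℓ) (λ S → (3 ∸ size S) * M S j)
      ≡⟨ weights G j ⟩
    r * suc p
      ≡⟨ trans (*-suc r p) (+-comm r (r * p)) ⟩
    r * p + r ∎)
    where
    open ≡-Reasoning
    pointwise : ∀ S → (3 ∸ size S) * M' (false ∷ S) j + (3 ∸ suc (size S)) * Y S j + Y S j
                    ≡ (3 ∸ size S) * M S j
    pointwise S = begin
      (3 ∸ size S) * M' (false ∷ S) j + (3 ∸ suc (size S)) * Y S j + Y S j
        ≡⟨ +-assoc ((3 ∸ size S) * M' (false ∷ S) j) _ _ ⟩
      (3 ∸ size S) * M' (false ∷ S) j + ((3 ∸ suc (size S)) * Y S j + Y S j)
        ≡⟨ cong ((3 ∸ size S) * M' (false ∷ S) j +_) (sym (∸-peel (size S) (Y S j) (Y-0 S j))) ⟩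
      (3 ∸ size S) * M' (false ∷ S) j + (3 ∸ size S) * Y S j
        ≡⟨ sym (*-distribˡ-+ (3 ∸ size S) _ _) ⟩
      (3 ∸ size S) * (M' (false ∷ S) j + Y S j)
        ≡⟨ cong ((3 ∸ size S) *_) (M'-split S j) ⟩
      (3 ∸ size S) * M S j ∎

  detach : Amalgam k r (suc ℓ) p
  detach = record { mult = M' ; rows = M'-rows ; degrees = M'-degrees ; weights = M'-weights }

  -- Three separated vertices leave no incidence to hand over, so the hyperedges among them keep
  -- their colours. This is why the given colouring survives all detachments.
  detach-old : ∀ S j → size S ≡ 3 → M' (false ∷ S) j ≡ M S j
  detach-old S j e rewrite Y-0 S j (≤-reflexive (sym e)) = refl

detachAll : ∀ p {k r ℓ n} → p + ℓ ≡ n → (G : Amalgam k r ℓ p) →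
  ∃[ H ] (∀ xs j → All (_< ℓ) xs → size (setOf ℓ xs) ≡ 3 →
            mult {k} {r} {n} {0} H (setOf n xs) j ≡ mult G (setOf ℓ xs) j)
detachAll zero refl G = G , λ _ _ _ _ → refl
detachAll (suc p) {ℓ = ℓ} {n} e G
  with detachAll p (trans (+-suc p ℓ) e) (Detach.detach G)
... | H , agree = H , λ xs j xs<ℓ s≡3 →
  let pad = setOf-pad xs<ℓ in
  trans (agree xs j (All.map m<n⇒m<1+n xs<ℓ) (trans (cong size pad) s≡3))
    (trans (cong (λ S → Detach.M' G S j) pad) (Detach.detach-old G (setOf ℓ xs) j s≡3))

-- Extending the given colouring to the amalgam with one merged vertex

sumFin-const : ∀ n c → sumFin {n} (λ _ → c) ≡ n * c
sumFin-const zero    c = refl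
sumFin-const (suc n) c = cong (c +_) (sumFin-const n c)

∑-allFin-const : ∀ n c → ∑ (allFin n) (λ _ → c) ≡ n * c
∑-allFin-const n c = trans (∑-tabulate {n = n} id (λ _ → c)) (sumFin-const n c)

∑-downFrom-const : ∀ m c → ∑ (downFrom m) (λ _ → c) ≡ m * c
∑-downFrom-const zero    c = refl
∑-downFrom-const (suc m) c = cong (c +_) (∑-downFrom-const m c)

term≤∑-downFrom : ∀ {m v} (f : ℕ → ℕ) → v < m → f v ≤ ∑ (downFrom m) f
term≤∑-downFrom {suc m} f v<1+m with m<1+n⇒m<n∨m≡n v<1+m
... | inj₁ v<m  = ≤-trans (term≤∑-downFrom f v<m) (m≤n+m _ (f m))
... | inj₂ refl = m≤m+n _ _

∑-mono-< : ∀ m {f g} → (∀ i → i < m → f i ≤ g i) → ∑ (downFrom m) f ≤ ∑ (downFrom m) g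
∑-mono-< zero h = z≤n
∑-mono-< (suc m) h = +-mono-≤ (h m ≤-refl) (∑-mono-< m λ i i<m → h i (m<n⇒m<1+n i<m))

distribute : ∀ a b c d → a * (b + c * d) ≡ a * b + c * (a * d)
distribute = solve-∀

mem-empty : ∀ {n} (S : Vec Bool n) v → size S ≡ 0 → mem S v ≡ false
mem-empty [] v e = refl
mem-empty {suc n} (false ∷ S) v e with does (v ≟ n)
... | false = mem-empty S v e
... | true  = refl

mem-singleton : ∀ {n v} u → v < n → ⟦ mem (setOf n (u ∷ [])) v ⟧ ≡ ⟦ does (v ≟ u) ⟧
mem-singleton {n} {v} u v<n = trans (cong ⟦_⟧ (mem-setOf (u ∷ []) v<n)) (∨-false (does (v ≟ u)))
  where
  ∨-false : ∀ b → ⟦ b ∨ false ⟧ ≡ ⟦ b ⟧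
  ∨-false false = refl
  ∨-false true  = refl

∑-singleton-mem : ∀ {m u} (G : Vec Bool m → ℕ) → u < m →
  ∑ (subsets m) (λ S → ⟦ does (size S ≟ 1) ⟧ * (⟦ mem S u ⟧ * G S)) ≡ G (setOf m (u ∷ []))
∑-singleton-mem {m} {u} G u<m = begin
  ∑ (subsets m) (λ S → ⟦ does (size S ≟ 1) ⟧ * (⟦ mem S u ⟧ * G S))
    ≡⟨ sym (∑-chains 1 m F) ⟩
  ∑ (chains 1 m) (λ xs → F (setOf m xs))
    ≡⟨ ∑-chains-suc 0 m (λ xs → F (setOf m xs)) ⟩
  ∑ (downFrom m) (λ a → F (setOf m (a ∷ [])) + 0)
    ≡⟨ ∑-cong (downFrom m) (λ a → trans (+-identityʳ _) (cong (_* G (setOf m (a ∷ [])))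
         (trans (mem-singleton a u<m) (cong ⟦_⟧ (does-sym _≟_ u a))))) ⟩
  ∑ (downFrom m) (λ a → ⟦ does (a ≟ u) ⟧ * G (setOf m (a ∷ [])))
    ≡⟨ ∑-downFrom-δ (λ a → G (setOf m (a ∷ []))) u<m ⟩
  G (setOf m (u ∷ [])) ∎
  where
  open ≡-Reasoning
  F : Vec Bool m → ℕ
  F S = ⟦ mem S u ⟧ * G S

∑-empty : ∀ m x → ∑ (subsets m) (λ S → ⟦ does (size S ≟ 0) ⟧ * x) ≡ x
∑-empty m x = trans (sym (∑-chains 0 m (λ _ → x))) (+-identityʳ x)

-- `T` is the given colouring as multiplicities and `t` the common size of the final classes;
-- `k * r` is the number of hyperedges at a vertex. `slack` keeps the greedy step from running out
-- of colours, and `2m≤p` keeps classes from exceeding `t`.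
module Start {k r t m p : ℕ} (T : Vec Bool m → Fin k → ℕ)
  (T-row : ∀ S → ∑ (allFin k) (T S) ≡ ⟦ does (size S ≟ 3) ⟧)
  (T-deg : ∀ v → v < m → ∀ j → ∑ (subsets m) (λ S → ⟦ mem S v ⟧ * T S j) ≤ r)
  (slack : k * r < 2 * completions p 1 + 2)
  (edges-at : ∀ v → v < m → ∑ (subsets m) (λ S → ⟦ mem S v ⟧ * completions p (size S)) ≡ k * r)
  (edges : ∑ (subsets m) (λ S → completions p (size S)) ≡ k * t)
  (class-size : r * (m + p) ≡ 3 * t)
  (2m≤p : 2 * m ≤ p)
  where

  module ES = Enum (subsetEnum m)
  module EF = Enum (finEnum k)

  Mult : Set
  Mult = Vec Bool m → Fin k → ℕ

  row : Mult → Vec Bool m → ℕ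
  row M S = ∑ (allFin k) (M S)

  degree : Mult → ℕ → Fin k → ℕ
  degree M v j = ∑ (subsets m) (λ S → ⟦ mem S v ⟧ * M S j)

  -- The hyperedges with at most one new vertex: one for each triple, `p` for each pair, none for
  -- any other set.
  cap : Vec Bool m → ℕ
  cap S = ⟦ does (2 ≤? size S) ⟧ * completions p (size S)

  ∑-degree : ∀ M v → ∑ (allFin k) (degree M v) ≡ ∑ (subsets m) (λ S → ⟦ mem S v ⟧ * row M S)
  ∑-degree M v = trans (∑-swap (allFin k) (subsets m) λ j S → ⟦ mem S v ⟧ * M S j)
    (∑-cong (subsets m) λ S → ∑-*ˡ (allFin k) ⟦ mem S v ⟧ (M S))

  -- The hyperedges at `v` outside `cap` are those with two new vertices, whose type is the
  -- singleton of `v`.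
  cap-degree : ∀ v → v < m → ∑ (subsets m) (λ S → ⟦ mem S v ⟧ * cap S) + completions p 1 ≡ k * r
  cap-degree v v<m = begin
    ∑ (subsets m) (λ S → ⟦ mem S v ⟧ * cap S) + completions p 1
      ≡⟨ cong (∑ (subsets m) (λ S → ⟦ mem S v ⟧ * cap S) +_)
           (sym (∑-singleton-mem {m} (λ _ → completions p 1) v<m)) ⟩
    ∑ (subsets m) (λ S → ⟦ mem S v ⟧ * cap S)
      + ∑ (subsets m) (λ S → ⟦ does (size S ≟ 1) ⟧ * (⟦ mem S v ⟧ * completions p 1))
      ≡⟨ sym (∑-+ (subsets m) _ _) ⟩
    ∑ (subsets m) (λ S → ⟦ mem S v ⟧ * cap S + ⟦ does (size S ≟ 1) ⟧ * (⟦ mem S v ⟧ * completions p 1))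
      ≡⟨ ∑-cong (subsets m) pointwise ⟩
    ∑ (subsets m) (λ S → ⟦ mem S v ⟧ * completions p (size S))
      ≡⟨ edges-at v v<m ⟩
    k * r ∎
    where
    open ≡-Reasoning
    pointwise : ∀ S → ⟦ mem S v ⟧ * cap S + ⟦ does (size S ≟ 1) ⟧ * (⟦ mem S v ⟧ * completions p 1)
                    ≡ ⟦ mem S v ⟧ * completions p (size S)
    pointwise S with size S in e
    ... | 0 rewrite mem-empty S v e = refl
    ... | 1 rewrite *-zeroʳ ⟦ mem S v ⟧ = *-identityˡ _
    ... | suc (suc s) = trans (+-identityʳ _) (cong (⟦ mem S v ⟧ *_) (*-identityˡ _))

  record Partial (M : Mult) : Set where
    field
      extends : ∀ S j → T S j ≤ M S j
      row≤cap : ∀ S → row M S ≤ cap S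
      deg≤r   : ∀ v → v < m → ∀ j → degree M v j ≤ r

  T-partial : Partial T
  T-partial = record
    { extends = λ _ _ → ≤-refl
    ; row≤cap = λ S → subst (_≤ cap S) (sym (T-row S)) (T≤cap S)
    ; deg≤r = T-deg
    }
    where
    T≤cap : ∀ S → ⟦ does (size S ≟ 3) ⟧ ≤ cap S
    T≤cap S with size S
    ... | 0 = z≤n
    ... | 1 = z≤n
    ... | 2 = z≤n
    ... | 3 rewrite completions-3 p = ≤-refl
    ... | suc (suc (suc (suc s))) = z≤n

  module Colour {M} (partial : Partial M) (S : Vec Bool m) (room : row M S < cap S) where
    open Partial partial

    -- The given colouring already fills the row of every triple, so only a pair can have room left.
    pair : size S ≡ 2
    pair = only-2 (size S) (subst (_≤ row M S) (T-row S) (∑-mono (allFin k) (extends S))) room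
      where
      only-2 : ∀ s {x} → ⟦ does (s ≟ 3) ⟧ ≤ x → x < ⟦ does (2 ≤? s) ⟧ * completions p s → s ≡ 2
      only-2 2 _ _ = refl
      only-2 3 {x} 1≤x lt = contradiction 1≤x (<⇒≱ (subst (x <_) (trans (*-identityˡ _) (completions-3 p)) lt))
      only-2 s@(suc (suc (suc (suc _)))) {x} _ lt = contradiction
        (subst (x <_) (trans (*-identityˡ _) (completions-large p {s} (s≤s (s≤s (s≤s (s≤s z≤n)))))) lt) λ ()

    full : ℕ → Fin k → ℕ
    full v j = ⟦ does (r ≤? degree M v j) ⟧

    bad : Fin k → ℕ
    bad j = ∑ (downFrom m) (λ v → ⟦ mem S v ⟧ * full v j)

    pair-degree : ℕ
    pair-degree = ∑ (downFrom m) (λ v → ⟦ mem S v ⟧ * ∑ (allFin k) (degree M v))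

    swapped : pair-degree ≡ ∑ (allFin k) (λ j → ∑ (downFrom m) (λ v → ⟦ mem S v ⟧ * degree M v j))
    swapped = trans (∑-cong (downFrom m) λ v → sym (∑-*ˡ (allFin k) ⟦ mem S v ⟧ (degree M v)))
      (∑-swap (downFrom m) (allFin k) λ v j → ⟦ mem S v ⟧ * degree M v j)

    all-bad : (∀ j → 0 < bad j) → k * r ≤ pair-degree
    all-bad pos = subst₂ _≤_ (∑-allFin-const k r) (sym swapped) (∑-mono (allFin k) at)
      where
      one : ∀ v j → r * (⟦ mem S v ⟧ * full v j) ≤ ⟦ mem S v ⟧ * degree M v j
      one v j with mem S v
      ... | false = ≤-reflexive (*-zeroʳ r)
      ... | true with r ≤? degree M v j
      ...   | yes le rewrite dec-true (r ≤? degree M v j) le =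
                subst₂ _≤_ (sym (*-identityʳ r)) (sym (*-identityˡ _)) le
      ...   | no ≰ rewrite dec-false (r ≤? degree M v j) ≰ = ≤-trans (≤-reflexive (*-zeroʳ r)) z≤n
      at : ∀ j → r ≤ ∑ (downFrom m) (λ v → ⟦ mem S v ⟧ * degree M v j)
      at j = begin
        r         ≡⟨ sym (*-identityʳ r) ⟩
        r * 1     ≤⟨ *-monoʳ-≤ r (pos j) ⟩
        r * bad j ≡⟨ sym (∑-*ˡ (downFrom m) r _) ⟩
        ∑ (downFrom m) (λ v → r * (⟦ mem S v ⟧ * full v j)) ≤⟨ ∑-mono (downFrom m) (λ v → one v j) ⟩
        ∑ (downFrom m) (λ v → ⟦ mem S v ⟧ * degree M v j) ∎
        where open ≤-Reasoning

    -- Each endpoint misses the hyperedges with two new vertices and, since `S` has room, at least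
    -- one more. This extra one is the `suc`, and over both endpoints it accounts for the `+ 2` in
    -- `slack`.
    pair-degree-bound : pair-degree + 2 * suc (completions p 1) ≤ 2 * (k * r)
    pair-degree-bound = begin
      pair-degree + 2 * suc c
        ≡⟨ cong (pair-degree +_) (cong (_* suc c) (trans (sym pair) (sym (∑-mem S)))) ⟩
      pair-degree + ∑ (downFrom m) (λ v → ⟦ mem S v ⟧) * suc c
        ≡⟨ cong (pair-degree +_) (sym (∑-*ʳ (downFrom m) (suc c) _)) ⟩
      pair-degree + ∑ (downFrom m) (λ v → ⟦ mem S v ⟧ * suc c)
        ≡⟨ sym (∑-+ (downFrom m) _ _) ⟩
      ∑ (downFrom m) (λ v → ⟦ mem S v ⟧ * ∑ (allFin k) (degree M v) + ⟦ mem S v ⟧ * suc c)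
        ≤⟨ ∑-mono-< m term ⟩
      ∑ (downFrom m) (λ v → ⟦ mem S v ⟧ * (k * r))
        ≡⟨ ∑-*ʳ (downFrom m) (k * r) _ ⟩
      ∑ (downFrom m) (λ v → ⟦ mem S v ⟧) * (k * r)
        ≡⟨ cong (_* (k * r)) (trans (∑-mem S) pair) ⟩
      2 * (k * r) ∎
      where
      open ≤-Reasoning
      c = completions p 1
      term : ∀ v → v < m → ⟦ mem S v ⟧ * ∑ (allFin k) (degree M v) + ⟦ mem S v ⟧ * suc c ≤ ⟦ mem S v ⟧ * (k * r)
      term v v<m with mem S v in e
      ... | false = z≤n
      ... | true = begin
        1 * ∑ (allFin k) (degree M v) + 1 * suc c
          ≡⟨ cong₂ _+_ (*-identityˡ (∑ (allFin k) (degree M v))) (*-identityˡ (suc c)) ⟩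
        ∑ (allFin k) (degree M v) + suc c
          ≡⟨ +-suc _ c ⟩
        suc (∑ (allFin k) (degree M v)) + c
          ≡⟨ cong (λ x → suc x + c) (∑-degree M v) ⟩
        suc (∑ (subsets m) (λ S' → ⟦ mem S' v ⟧ * row M S')) + c
          ≤⟨ +-monoˡ-≤ c (ES.total-mono-< (λ S' → *-monoʳ-≤ ⟦ mem S' v ⟧ (row≤cap S')) S
               (subst (λ b → ⟦ b ⟧ * row M S < ⟦ b ⟧ * cap S) (sym e)
                 (subst₂ _<_ (sym (*-identityˡ _)) (sym (*-identityˡ _)) room))) ⟩
        ∑ (subsets m) (λ S' → ⟦ mem S' v ⟧ * cap S') + c
          ≡⟨ cap-degree v v<m ⟩
        k * r
          ≡⟨ sym (*-identityˡ _) ⟩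
        1 * (k * r) ∎

    -- If every colour were full at an endpoint of S, the two degree sums would add up to at least
    -- k r, whereas cap-degree bounds each of them by k r - (completions p 1 + 1).
    not-all-bad : ¬ (∀ j → 0 < bad j)
    not-all-bad pos = <⇒≱ slack (+-cancelˡ-≤ (k * r) _ _ (begin
      k * r + (2 * c + 2)   ≡⟨ cong (k * r +_) (rearrange c) ⟩
      k * r + 2 * suc c     ≤⟨ +-monoˡ-≤ _ (all-bad pos) ⟩
      pair-degree + 2 * suc c ≤⟨ pair-degree-bound ⟩
      2 * (k * r)           ≡⟨ cong (k * r +_) (+-identityʳ _) ⟩
      k * r + k * r         ∎))
      where
      open ≤-Reasoning
      c = completions p 1
      rearrange : ∀ c → 2 * c + 2 ≡ 2 * suc c
      rearrange = solve-∀

    available : ∃[ j ] bad j ≡ 0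
    available with EF.search (λ j → ⟦ does (bad j ≟ 0) ⟧)
    ... | inj₂ none = contradiction pos not-all-bad
      where
      pos : ∀ j → 0 < bad j
      pos j with bad j | none j
      ... | suc _ | _ = z<s
    ... | inj₁ (j , found) with bad j in e
    ...   | zero = j , e

    j₀ : Fin k
    j₀ = proj₁ available

    coloured : Mult
    coloured S' j = M S' j + ES.δ S' S * EF.δ j j₀

    coloured-row : ∀ S' → row coloured S' ≡ row M S' + ES.δ S' S
    coloured-row S' = trans (∑-+ (allFin k) (M S') _) (cong (row M S' +_)
      (trans (∑-*ˡ (allFin k) (ES.δ S' S) _) (trans (cong (ES.δ S' S *_) (EF.once j₀)) (*-identityʳ _))))

    coloured-degree : ∀ v j → degree coloured v j ≡ degree M v j + ⟦ mem S v ⟧ * EF.δ j j₀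
    coloured-degree v j = begin
      degree coloured v j
        ≡⟨ ∑-cong (subsets m) (λ S' → distribute ⟦ mem S' v ⟧ (M S' j) (ES.δ S' S) (EF.δ j j₀)) ⟩
      ∑ (subsets m) (λ S' → ⟦ mem S' v ⟧ * M S' j + ES.δ S' S * (⟦ mem S' v ⟧ * EF.δ j j₀))
        ≡⟨ ∑-+ (subsets m) _ _ ⟩
      degree M v j + ∑ (subsets m) (λ S' → ES.δ S' S * (⟦ mem S' v ⟧ * EF.δ j j₀))
        ≡⟨ cong (degree M v j +_) (ES.total-δ (λ S' → ⟦ mem S' v ⟧ * EF.δ j j₀) S) ⟩
      degree M v j + ⟦ mem S v ⟧ * EF.δ j j₀ ∎
      where open ≡-Reasoning

    coloured-partial : Partial coloured
    coloured-partial = record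
      { extends = λ S' j → ≤-trans (extends S' j) (m≤m+n _ _)
      ; row≤cap = λ S' → subst (_≤ cap S') (sym (coloured-row S')) (rows≤ S')
      ; deg≤r = λ v v<m j → subst (_≤ r) (sym (coloured-degree v j)) (degrees≤ v v<m j)
      }
      where
      rows≤ : ∀ S' → row M S' + ES.δ S' S ≤ cap S'
      rows≤ S' with S' ES.≟ₑ S
      ... | yes refl = subst (_≤ cap S') (+-comm 1 (row M S')) room
      ... | no _     = subst (_≤ cap S') (sym (+-identityʳ _)) (row≤cap S')
      degrees≤ : ∀ v → v < m → ∀ j → degree M v j + ⟦ mem S v ⟧ * EF.δ j j₀ ≤ r
      degrees≤ v v<m j with mem S v in e | j EF.≟ₑ j₀
      ... | false | _        = subst (_≤ r) (sym (+-identityʳ _)) (deg≤r v v<m j)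
      ... | true  | no _     = subst (_≤ r) (sym (+-identityʳ _)) (deg≤r v v<m j)
      ... | true  | yes refl with r ≤? degree M v j
      ...   | no ≰ = subst (_≤ r) (+-comm 1 (degree M v j)) (≰⇒> ≰)
      ...   | yes le = contradiction
                (subst₂ (λ b c → ⟦ b ⟧ * ⟦ c ⟧ ≤ 0) e (dec-true (r ≤? degree M v j) le)
                  (subst (⟦ mem S v ⟧ * full v j ≤_) (proj₂ available)
                    (term≤∑-downFrom (λ v → ⟦ mem S v ⟧ * full v j) v<m))) λ ()

  greedy : ∀ fuel M → Partial M → ∑ (subsets m) (λ S → cap S ∸ row M S) ≤ fuel →
           ∃[ M' ] Partial M' × (∀ S → row M' S ≡ cap S)
  greedy fuel M partial le with ES.search (λ S → cap S ∸ row M S)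
  ... | inj₂ none = M , partial , λ S → ≤-antisym (Partial.row≤cap partial S) (m∸n≡0⇒m≤n (none S))
  ... | inj₁ (S , pos) with fuel
  ...   | zero  = contradiction (n≤0⇒n≡0 (≤-trans (ES.term≤total (λ S → cap S ∸ row M S) S) le)) (m<n⇒n≢0 pos)
  ...   | suc f = greedy f coloured coloured-partial (≤-pred (≤-trans smaller le))
    where
    room : row M S < cap S
    room = 0<n∸m⇒m<n pos
    open Colour partial S room
    smaller : ∑ (subsets m) (λ S → cap S ∸ row coloured S) < ∑ (subsets m) (λ S → cap S ∸ row M S)
    smaller = ES.total-mono-<
      (λ S' → ∸-monoʳ-≤ (cap S') (subst (row M S' ≤_) (sym (coloured-row S')) (m≤m+n _ _))) S
      (∸-monoʳ-< (subst (row M S <_) (sym (trans (coloured-row S) (cong (row M S +_) (ES.δ-refl S))))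
                    (subst (row M S <_) (+-comm 1 (row M S)) ≤-refl))
                 (Partial.row≤cap coloured-partial S))

  abstract
    greedy-colouring : ∃[ M ] Partial M × (∀ S → row M S ≡ cap S)
    greedy-colouring = greedy _ T T-partial ≤-refl

  M₂ : Mult
  M₂ = proj₁ greedy-colouring

  M₂-partial : Partial M₂
  M₂-partial = proj₁ (proj₂ greedy-colouring)

  M₂-row : ∀ S → row M₂ S ≡ cap S
  M₂-row = proj₂ (proj₂ greedy-colouring)

  -- On a singleton this is the deficit of its vertex; the sum over members reads it off without
  -- extracting that vertex from `S`.
  missing : Vec Bool m → Fin k → ℕ
  missing S j = ∑ (downFrom m) (λ v → ⟦ mem S v ⟧ * (r ∸ degree M₂ v j))

  M₁ : Mult
  M₁ S j = M₂ S j + ⟦ does (size S ≟ 1) ⟧ * missing S j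

  M₁-degree : ∀ v → v < m → ∀ j → degree M₁ v j ≡ r
  M₁-degree v v<m j = begin
    degree M₁ v j
      ≡⟨ ∑-cong (subsets m) (λ S → distribute ⟦ mem S v ⟧ (M₂ S j) ⟦ does (size S ≟ 1) ⟧ (missing S j)) ⟩
    ∑ (subsets m) (λ S → ⟦ mem S v ⟧ * M₂ S j + ⟦ does (size S ≟ 1) ⟧ * (⟦ mem S v ⟧ * missing S j))
      ≡⟨ ∑-+ (subsets m) _ _ ⟩
    degree M₂ v j + ∑ (subsets m) (λ S → ⟦ does (size S ≟ 1) ⟧ * (⟦ mem S v ⟧ * missing S j))
      ≡⟨ cong (degree M₂ v j +_) (∑-singleton-mem {m} (λ S → missing S j) v<m) ⟩
    degree M₂ v j + missing (setOf m (v ∷ [])) j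
      ≡⟨ cong (degree M₂ v j +_) (trans
           (∑-cong-< m λ u u<m → cong (_* (r ∸ degree M₂ u j)) (mem-singleton v u<m))
           (∑-downFrom-δ (λ u → r ∸ degree M₂ u j) v<m)) ⟩
    degree M₂ v j + (r ∸ degree M₂ v j)
      ≡⟨ m+[n∸m]≡n (Partial.deg≤r M₂-partial v v<m j) ⟩
    r ∎
    where open ≡-Reasoning

  -- All of `cap` is coloured by now, so what `v` lacks over all colours is `k * r` minus its degree
  -- in `cap`: exactly the supply of hyperedges with two new vertices.
  missing-total : ∀ v → v < m → ∑ (allFin k) (λ j → r ∸ degree M₂ v j) ≡ completions p 1
  missing-total v v<m = +-cancelʳ-≡ (∑ (allFin k) (degree M₂ v)) _ _ (begin
    ∑ (allFin k) (λ j → r ∸ degree M₂ v j) + ∑ (allFin k) (degree M₂ v)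
      ≡⟨ sym (∑-+ (allFin k) _ _) ⟩
    ∑ (allFin k) (λ j → r ∸ degree M₂ v j + degree M₂ v j)
      ≡⟨ ∑-cong (allFin k) (λ j → m∸n+n≡m (Partial.deg≤r M₂-partial v v<m j)) ⟩
    ∑ (allFin k) (λ _ → r)
      ≡⟨ ∑-allFin-const k r ⟩
    k * r
      ≡⟨ sym (cap-degree v v<m) ⟩
    ∑ (subsets m) (λ S → ⟦ mem S v ⟧ * cap S) + completions p 1
      ≡⟨ +-comm _ (completions p 1) ⟩
    completions p 1 + ∑ (subsets m) (λ S → ⟦ mem S v ⟧ * cap S)
      ≡⟨ cong (completions p 1 +_) (∑-cong (subsets m) λ S → cong (⟦ mem S v ⟧ *_) (sym (M₂-row S))) ⟩
    completions p 1 + ∑ (subsets m) (λ S → ⟦ mem S v ⟧ * row M₂ S)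
      ≡⟨ cong (completions p 1 +_) (sym (∑-degree M₂ v)) ⟩
    completions p 1 + ∑ (allFin k) (degree M₂ v) ∎)
    where open ≡-Reasoning

  missing-row : ∀ S → row missing S ≡ size S * completions p 1
  missing-row S = begin
    row missing S
      ≡⟨ ∑-swap (allFin k) (downFrom m) (λ j v → ⟦ mem S v ⟧ * (r ∸ degree M₂ v j)) ⟩
    ∑ (downFrom m) (λ v → ∑ (allFin k) (λ j → ⟦ mem S v ⟧ * (r ∸ degree M₂ v j)))
      ≡⟨ ∑-cong-< m (λ v v<m → trans (∑-*ˡ (allFin k) ⟦ mem S v ⟧ _)
           (cong (⟦ mem S v ⟧ *_) (missing-total v v<m))) ⟩
    ∑ (downFrom m) (λ v → ⟦ mem S v ⟧ * completions p 1)
      ≡⟨ ∑-*ʳ (downFrom m) (completions p 1) _ ⟩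
    ∑ (downFrom m) (λ v → ⟦ mem S v ⟧) * completions p 1
      ≡⟨ cong (_* completions p 1) (∑-mem S) ⟩
    size S * completions p 1 ∎
    where open ≡-Reasoning

  M₁-row : ∀ S → row M₁ S + ⟦ does (size S ≟ 0) ⟧ * completions p 0 ≡ completions p (size S)
  M₁-row S = trans (cong (_+ ⟦ does (size S ≟ 0) ⟧ * completions p 0)
      (trans (∑-+ (allFin k) (M₂ S) _) (cong₂ _+_ (M₂-row S)
        (trans (∑-*ˡ (allFin k) ⟦ does (size S ≟ 1) ⟧ (missing S)) (cong (⟦ does (size S ≟ 1) ⟧ *_) (missing-row S))))))
    (cases (size S))
    where
    cases : ∀ s → ⟦ does (2 ≤? s) ⟧ * completions p s + ⟦ does (s ≟ 1) ⟧ * (s * completions p 1)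
                    + ⟦ does (s ≟ 0) ⟧ * completions p 0 ≡ completions p s
    cases 0 = *-identityˡ _
    cases 1 = trans (+-identityʳ _) (trans (*-identityˡ _) (*-identityˡ _))
    cases (suc (suc s)) = trans (+-identityʳ _) (trans (+-identityʳ _) (*-identityˡ _))

  ∑-size : ∀ M j → ∑ (subsets m) (λ S → size S * M S j) ≡ ∑ (downFrom m) (λ v → degree M v j)
  ∑-size M j = begin
    ∑ (subsets m) (λ S → size S * M S j)
      ≡⟨ ∑-cong (subsets m) (λ S → trans (cong (_* M S j) (sym (∑-mem S)))
           (sym (∑-*ʳ (downFrom m) (M S j) _))) ⟩
    ∑ (subsets m) (λ S → ∑ (downFrom m) (λ v → ⟦ mem S v ⟧ * M S j))
      ≡⟨ ∑-swap (subsets m) (downFrom m) (λ S v → ⟦ mem S v ⟧ * M S j) ⟩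
    ∑ (downFrom m) (λ v → degree M v j) ∎
    where open ≡-Reasoning

  used : Fin k → ℕ
  used j = ∑ (subsets m) (λ S → M₁ S j)

  -- Every hyperedge coloured so far has a vertex in the old part, so a class has at most `m * r` of
  -- them; since `2 * m` is at most `p`, this is at most a third of `r * (m + p)`.
  used≤t : ∀ j → used j ≤ t
  used≤t j = *-cancelˡ-≤ 3 (begin
    3 * used j                                  ≤⟨ *-monoʳ-≤ 3 (∑-mono (subsets m) le-size) ⟩
    3 * ∑ (subsets m) (λ S → size S * M₁ S j)   ≡⟨ cong (3 *_) (∑-size M₁ j) ⟩
    3 * ∑ (downFrom m) (λ v → degree M₁ v j)    ≡⟨ cong (3 *_) (∑-cong-< m λ v v<m → M₁-degree v v<m j) ⟩
    3 * ∑ (downFrom m) (λ _ → r)                ≡⟨ cong (3 *_) (∑-downFrom-const m r) ⟩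
    3 * (m * r)                                 ≡⟨ rearrange m r ⟩
    r * (m + 2 * m)                             ≤⟨ *-monoʳ-≤ r (+-monoʳ-≤ m 2m≤p) ⟩
    r * (m + p)                                 ≡⟨ class-size ⟩
    3 * t                                       ∎)
    where
    open ≤-Reasoning
    rearrange : ∀ m r → 3 * (m * r) ≡ r * (m + 2 * m)
    rearrange = solve-∀
    ≤-scale : ∀ s x → (s ≡ 0 → x ≡ 0) → x ≤ s * x
    ≤-scale zero    x h = ≤-reflexive (h refl)
    ≤-scale (suc s) x h = m≤m+n x (s * x)
    empty-row : ∀ S → size S ≡ 0 → row M₁ S ≡ 0
    empty-row S e = +-cancelʳ-≡ (completions p 0) _ _
      (trans (cong (row M₁ S +_) (sym (*-identityˡ _)))
        (subst (λ s → row M₁ S + ⟦ does (s ≟ 0) ⟧ * completions p 0 ≡ completions p s) e (M₁-row S)))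
    le-size : ∀ S → M₁ S j ≤ size S * M₁ S j
    le-size S = ≤-scale (size S) (M₁ S j) λ e →
      n≤0⇒n≡0 (subst (M₁ S j ≤_) (empty-row S e) (EF.term≤total (M₁ S) j))

  M₀ : Mult
  M₀ S j = M₁ S j + ⟦ does (size S ≟ 0) ⟧ * (t ∸ used j)

  ∑-used : ∑ (allFin k) used + completions p 0 ≡ k * t
  ∑-used = begin
    ∑ (allFin k) used + completions p 0
      ≡⟨ cong₂ _+_ (∑-swap (allFin k) (subsets m) λ j S → M₁ S j) (sym (∑-empty m (completions p 0))) ⟩
    ∑ (subsets m) (row M₁) + ∑ (subsets m) (λ S → ⟦ does (size S ≟ 0) ⟧ * completions p 0)
      ≡⟨ sym (∑-+ (subsets m) _ _) ⟩
    ∑ (subsets m) (λ S → row M₁ S + ⟦ does (size S ≟ 0) ⟧ * completions p 0)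
      ≡⟨ ∑-cong (subsets m) M₁-row ⟩
    ∑ (subsets m) (λ S → completions p (size S))
      ≡⟨ edges ⟩
    k * t ∎
    where open ≡-Reasoning

  ∑-unused : ∑ (allFin k) (λ j → t ∸ used j) ≡ completions p 0
  ∑-unused = +-cancelˡ-≡ (∑ (allFin k) used) _ _ (begin
    ∑ (allFin k) used + ∑ (allFin k) (λ j → t ∸ used j) ≡⟨ sym (∑-+ (allFin k) _ _) ⟩
    ∑ (allFin k) (λ j → used j + (t ∸ used j))          ≡⟨ ∑-cong (allFin k) (λ j → m+[n∸m]≡n (used≤t j)) ⟩
    ∑ (allFin k) (λ _ → t)                              ≡⟨ ∑-allFin-const k t ⟩
    k * t                                               ≡⟨ sym ∑-used ⟩
    ∑ (allFin k) used + completions p 0                 ∎)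
    where open ≡-Reasoning

  M₀-row : ∀ S → row M₀ S ≡ completions p (size S)
  M₀-row S = trans (∑-+ (allFin k) (M₁ S) _)
    (trans (cong (row M₁ S +_) (trans (∑-*ˡ (allFin k) ⟦ does (size S ≟ 0) ⟧ _)
      (cong (⟦ does (size S ≟ 0) ⟧ *_) ∑-unused))) (M₁-row S))

  M₀-degree : ∀ v → v < m → ∀ j → degree M₀ v j ≡ r
  M₀-degree v v<m j = trans (∑-cong (subsets m) pointwise) (M₁-degree v v<m j)
    where
    pointwise : ∀ S → ⟦ mem S v ⟧ * M₀ S j ≡ ⟦ mem S v ⟧ * M₁ S j
    pointwise S with size S in e
    ... | zero rewrite mem-empty S v e = refl
    ... | suc _ = cong (⟦ mem S v ⟧ *_) (+-identityʳ _)

  -- A class of `t` hyperedges has `3 * t = r * (m + p)` incidences, of which `m * r` lie at old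
  -- vertices; the remaining `r * p` fall on the merged vertex.
  M₀-weight : ∀ j → ∑ (subsets m) (λ S → (3 ∸ size S) * M₀ S j) ≡ r * p
  M₀-weight j = +-cancelʳ-≡ (m * r) _ _ (begin
    ∑ (subsets m) (λ S → (3 ∸ size S) * M₀ S j) + m * r
      ≡⟨ cong (∑ (subsets m) (λ S → (3 ∸ size S) * M₀ S j) +_) (sym (trans (∑-size M₀ j)
           (trans (∑-cong-< m λ v v<m → M₀-degree v v<m j) (∑-downFrom-const m r)))) ⟩
    ∑ (subsets m) (λ S → (3 ∸ size S) * M₀ S j) + ∑ (subsets m) (λ S → size S * M₀ S j)
      ≡⟨ sym (∑-+ (subsets m) _ _) ⟩
    ∑ (subsets m) (λ S → (3 ∸ size S) * M₀ S j + size S * M₀ S j)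
      ≡⟨ ∑-cong (subsets m) pointwise ⟩
    ∑ (subsets m) (λ S → 3 * M₀ S j)
      ≡⟨ ∑-*ˡ (subsets m) 3 _ ⟩
    3 * ∑ (subsets m) (λ S → M₀ S j)
      ≡⟨ cong (3 *_) (trans (∑-+ (subsets m) _ _) (trans (cong (used j +_) (∑-empty m (t ∸ used j)))
           (m+[n∸m]≡n (used≤t j)))) ⟩
    3 * t
      ≡⟨ sym class-size ⟩
    r * (m + p)
      ≡⟨ rearrange r m p ⟩
    r * p + m * r ∎)
    where
    open ≡-Reasoning
    rearrange : ∀ r m p → r * (m + p) ≡ r * p + m * r
    rearrange = solve-∀
    pointwise : ∀ S → (3 ∸ size S) * M₀ S j + size S * M₀ S j ≡ 3 * M₀ S j
    pointwise S with size S ≤? 3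
    ... | yes le = trans (sym (*-distribʳ-+ (M₀ S j) (3 ∸ size S) (size S)))
                         (cong (_* M₀ S j) (m∸n+n≡m le))
    ... | no ¬le = trans (cong₂ (λ x y → (3 ∸ size S) * x + size S * y) zero-mult zero-mult)
                     (trans (cong₂ _+_ (*-zeroʳ (3 ∸ size S)) (*-zeroʳ (size S))) (cong (3 *_) (sym zero-mult)))
      where
      zero-mult : M₀ S j ≡ 0
      zero-mult = n≤0⇒n≡0 (subst (M₀ S j ≤_) (trans (M₀-row S) (completions-large p (≰⇒> ¬le)))
                            (EF.term≤total (M₀ S) j))

  amalgam : Amalgam k r m p
  amalgam = record { mult = M₀ ; rows = M₀-row ; degrees = M₀-degree ; weights = M₀-weight }

  amalgam-extends : ∀ S j → T S j ≤ mult amalgam S j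
  amalgam-extends S j = ≤-trans (Partial.extends M₂-partial S j) (≤-trans (m≤m+n _ _) (m≤m+n _ _))

-- Ordered triples versus vertex sets of size three

term≤∑ : ∀ {x : A} {xs} (f : A → ℕ) → x ∈ xs → f x ≤ ∑ xs f
term≤∑ f (here refl)  = m≤m+n _ _
term≤∑ {xs = y ∷ _} f (there x∈xs) = ≤-trans (term≤∑ f x∈xs) (m≤n+m _ (f y))

∑-cartesianProduct : ∀ (xs : List A) (ys : List B) (f : A × B → ℕ) →
  ∑ (cartesianProduct xs ys) f ≡ ∑ xs (λ x → ∑ ys (λ y → f (x , y)))
∑-cartesianProduct [] ys f = refl
∑-cartesianProduct (x ∷ xs) ys f = trans (∑-++ (map (x ,_) ys) _ f)
  (cong₂ _+_ (∑-map (x ,_) ys f) (∑-cartesianProduct xs ys f))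

∑-filter-< : ∀ {n d} (f : ℕ → ℕ) → d ≤ n →
  ∑ (downFrom n) (λ b → ⟦ does (b <? d) ⟧ * f b) ≡ ∑ (downFrom d) f
∑-filter-< {n} {d} f d≤n with m≤n⇒m<n∨m≡n d≤n
... | inj₂ refl = ∑-cong-< n λ b b<n →
        trans (cong (λ c → ⟦ c ⟧ * f b) (dec-true (b <? n) b<n)) (*-identityˡ (f b))
∑-filter-< {suc n} {d} f _ | inj₁ (s≤s d≤n) =
  trans (cong (λ c → ⟦ c ⟧ * f n + ∑ (downFrom n) (λ b → ⟦ does (b <? d) ⟧ * f b)) (dec-false (n <? d) (≤⇒≯ d≤n)))
        (∑-filter-< f d≤n)

triples : ∀ n → List (Fin n × Fin n × Fin n)
triples n = cartesianProduct (allFin n) (cartesianProduct (allFin n) (allFin n))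

∑-allFin : ∀ n (f : Fin n → ℕ) → ∑ (allFin n) f ≡ sumFin f
∑-allFin n f = ∑-tabulate {n = n} id f

∑-triples : ∀ n f → ∑ (triples n) f ≡ sumFin (λ a → sumFin (λ b → sumFin (λ d → f (a , b , d))))
∑-triples n f = begin
  ∑ (triples n) f
    ≡⟨ ∑-cartesianProduct (allFin n) (cartesianProduct (allFin n) (allFin n)) f ⟩
  ∑ (allFin n) (λ a → ∑ (cartesianProduct (allFin n) (allFin n)) (λ bd → f (a , bd)))
    ≡⟨ ∑-allFin n _ ⟩
  sumFin (λ a → ∑ (cartesianProduct (allFin n) (allFin n)) (λ bd → f (a , bd)))
    ≡⟨ sumFin-cong (λ a → trans (∑-cartesianProduct (allFin n) (allFin n) (λ bd → f (a , bd)))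
         (trans (∑-allFin n _) (sumFin-cong λ b → ∑-allFin n (λ d → f (a , b , d))))) ⟩
  sumFin (λ a → sumFin (λ b → sumFin (λ d → f (a , b , d)))) ∎
  where open ≡-Reasoning

ordered : ℕ → ℕ → ℕ → ℕ
ordered a b d = ⟦ does (a <? b) ⟧ * ⟦ does (b <? d) ⟧

vset : ∀ {n} → Fin n → Fin n → Fin n → Vec Bool n
vset {n} a b d = setOf n (toℕ d ∷ toℕ b ∷ toℕ a ∷ [])

-- The summations are interchanged until the largest vertex is outermost, after which the order
-- tests shorten the inner ranges and the nested sum is the one over `chains 3 n`.
∑-ordered : ∀ n (F : Vec Bool n → ℕ) →
  ∑ (triples n) (λ (a , b , d) → ordered (toℕ a) (toℕ b) (toℕ d) * F (vset a b d))
    ≡ ∑ (subsets n) (λ S → ⟦ does (size S ≟ 3) ⟧ * F S)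
∑-ordered n F = begin
  ∑ (triples n) (λ (a , b , d) → ordered (toℕ a) (toℕ b) (toℕ d) * F (vset a b d))
    ≡⟨ ∑-triples n _ ⟩
  sumFin {n} (λ a → sumFin {n} (λ b → sumFin {n} (λ d → H (toℕ a) (toℕ b) (toℕ d))))
    ≡⟨ sumFin-cong {n} (λ a → trans (sumFin-cong {n} λ b → sumFin-toℕ n (H (toℕ a) (toℕ b)))
         (sumFin-toℕ n (λ b → ∑ (downFrom n) (H (toℕ a) b)))) ⟩
  sumFin {n} (λ a → ∑ (downFrom n) (λ b → ∑ (downFrom n) (H (toℕ a) b)))
    ≡⟨ sumFin-toℕ n (λ a → ∑ (downFrom n) (λ b → ∑ (downFrom n) (H a b))) ⟩
  ∑ (downFrom n) (λ a → ∑ (downFrom n) (λ b → ∑ (downFrom n) (H a b)))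
    ≡⟨ ∑-cong (downFrom n) (λ a → ∑-swap (downFrom n) (downFrom n) (H a)) ⟩
  ∑ (downFrom n) (λ a → ∑ (downFrom n) (λ d → ∑ (downFrom n) (λ b → H a b d)))
    ≡⟨ ∑-swap (downFrom n) (downFrom n) (λ a d → ∑ (downFrom n) (λ b → H a b d)) ⟩
  ∑ (downFrom n) (λ d → ∑ (downFrom n) (λ a → ∑ (downFrom n) (λ b → H a b d)))
    ≡⟨ ∑-cong (downFrom n) (λ d → ∑-swap (downFrom n) (downFrom n) (λ a b → H a b d)) ⟩
  ∑ (downFrom n) (λ d → ∑ (downFrom n) (λ b → ∑ (downFrom n) (λ a → H a b d)))
    ≡⟨ ∑-cong-< n (λ d d<n → trans (∑-cong-< n (λ b b<n → inner d b b<n))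
         (∑-filter-< (λ b → ∑ (downFrom b) (λ a → G a b d)) (<⇒≤ d<n))) ⟩
  ∑ (downFrom n) (λ d → ∑ (downFrom d) (λ b → ∑ (downFrom b) (λ a → G a b d)))
    ≡⟨ ∑-cong (downFrom n) (λ d → ∑-cong (downFrom d) λ b → ∑-cong (downFrom b) λ a → sym (+-identityʳ _)) ⟩
  ∑ (downFrom n) (λ d → ∑ (downFrom d) (λ b → ∑ (downFrom b) (λ a → G a b d + 0)))
    ≡⟨ ∑-cong (downFrom n) (λ d → ∑-cong (downFrom d) λ b →
         sym (∑-chains-suc 0 b (λ xs → F (setOf n (d ∷ b ∷ xs))))) ⟩
  ∑ (downFrom n) (λ d → ∑ (downFrom d) (λ b → ∑ (chains 1 b) (λ xs → F (setOf n (d ∷ b ∷ xs)))))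
    ≡⟨ ∑-cong (downFrom n) (λ d → sym (∑-chains-suc 1 d (λ xs → F (setOf n (d ∷ xs))))) ⟩
  ∑ (downFrom n) (λ d → ∑ (chains 2 d) (λ xs → F (setOf n (d ∷ xs))))
    ≡⟨ sym (∑-chains-suc 2 n (λ xs → F (setOf n xs))) ⟩
  ∑ (chains 3 n) (λ xs → F (setOf n xs))
    ≡⟨ ∑-chains 3 n F ⟩
  ∑ (subsets n) (λ S → ⟦ does (size S ≟ 3) ⟧ * F S) ∎
  where
  open ≡-Reasoning
  G : ℕ → ℕ → ℕ → ℕ
  G a b d = F (setOf n (d ∷ b ∷ a ∷ []))
  H : ℕ → ℕ → ℕ → ℕ
  H a b d = ordered a b d * G a b d
  inner : ∀ d b → b < n → ∑ (downFrom n) (λ a → H a b d) ≡ ⟦ does (b <? d) ⟧ * ∑ (downFrom b) (λ a → G a b d)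
  inner d b b<n = begin
    ∑ (downFrom n) (λ a → H a b d)
      ≡⟨ ∑-cong (downFrom n) (λ a → *-assoc ⟦ does (a <? b) ⟧ ⟦ does (b <? d) ⟧ (G a b d)) ⟩
    ∑ (downFrom n) (λ a → ⟦ does (a <? b) ⟧ * (⟦ does (b <? d) ⟧ * G a b d))
      ≡⟨ ∑-filter-< (λ a → ⟦ does (b <? d) ⟧ * G a b d) (<⇒≤ b<n) ⟩
    ∑ (downFrom b) (λ a → ⟦ does (b <? d) ⟧ * G a b d)
      ≡⟨ ∑-*ˡ (downFrom b) ⟦ does (b <? d) ⟧ _ ⟩
    ⟦ does (b <? d) ⟧ * ∑ (downFrom b) (λ a → G a b d) ∎

-- `contrib` with its dependence on the vertex removed: the colour test stays here, and incidence
-- becomes a separate factor, so that sums over vertices, colours and triples can be interchanged.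
χ : ∀ {n k} → (Triple n → Fin k) → Fin k → Fin n → Fin n → Fin n → ℕ
χ c j a b d with a Fin.<? b | b Fin.<? d
... | yes p | yes q = ⟦ does (c (tri a b d p q) Fin.≟ j) ⟧
... | _     | _     = 0

does-toℕ : ∀ {n} (v a : Fin n) → does (toℕ v ≟ toℕ a) ≡ does (v Fin.≟ a)
does-toℕ v a with v Fin.≟ a
... | yes refl = dec-true (toℕ v ≟ toℕ v) refl
... | no v≢a   = dec-false (toℕ v ≟ toℕ a) (v≢a ∘ Fin.toℕ-injective)

contrib-χ : ∀ {n k} (c : Triple n → Fin k) j v a b d →
  contrib c j v a b d ≡ χ c j a b d * ⟦ mem (vset a b d) (toℕ v) ⟧
contrib-χ c j v a b d
  rewrite mem-setOf (toℕ d ∷ toℕ b ∷ toℕ a ∷ []) (Fin.toℕ<n v)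
        | does-toℕ v a | does-toℕ v b | does-toℕ v d
  with a Fin.<? b | b Fin.<? d
... | no _  | _     = refl
... | yes _ | no _  = refl
... | yes p | yes q with c (tri a b d p q) Fin.≟ j
...   | no _ = refl
...   | yes _ with v Fin.≟ a | v Fin.≟ b | v Fin.≟ d
...     | no _  | no _  | no _  = refl
...     | yes _ | yes _ | yes _ = refl
...     | yes _ | yes _ | no _  = refl
...     | yes _ | no _  | yes _ = refl
...     | yes _ | no _  | no _  = refl
...     | no _  | yes _ | yes _ = refl
...     | no _  | yes _ | no _  = refl
...     | no _  | no _  | yes _ = refl

deg-χ : ∀ {n k} (c : Triple n → Fin k) j v →
  deg c j v ≡ ∑ (triples n) (λ (a , b , d) → χ c j a b d * ⟦ mem (vset a b d) (toℕ v) ⟧)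
deg-χ {n} c j v = trans
  (sumFin-cong λ a → sumFin-cong λ b → sumFin-cong λ d → contrib-χ c j v a b d)
  (sym (∑-triples n _))

ordered-yes : ∀ {a b d} → a < b → b < d → ordered a b d ≡ 1
ordered-yes {a} {b} {d} a<b b<d =
  cong₂ (λ x y → ⟦ x ⟧ * ⟦ y ⟧) (dec-true (a <? b) a<b) (dec-true (b <? d) b<d)

ordered-noˡ : ∀ {a b d} → ¬ (a < b) → ordered a b d ≡ 0
ordered-noˡ {a} {b} {d} ≮ = cong (λ x → ⟦ x ⟧ * ⟦ does (b <? d) ⟧) (dec-false (a <? b) ≮)

ordered-noʳ : ∀ {a b d} → ¬ (b < d) → ordered a b d ≡ 0
ordered-noʳ {a} {b} {d} ≮ =
  trans (cong (λ x → ⟦ does (a <? b) ⟧ * ⟦ x ⟧) (dec-false (b <? d) ≮)) (*-zeroʳ ⟦ does (a <? b) ⟧)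

∑-χ : ∀ {n k} (c : Triple n → Fin k) a b d →
  ∑ (allFin k) (λ j → χ c j a b d) ≡ ordered (toℕ a) (toℕ b) (toℕ d)
∑-χ {n} {k} c a b d with a Fin.<? b | b Fin.<? d
... | no ≮  | _     = trans (∑-0 (allFin k)) (sym (ordered-noˡ {d = toℕ d} ≮))
... | yes _ | no ≮  = trans (∑-0 (allFin k)) (sym (ordered-noʳ ≮))
... | yes p | yes q = trans (trans
  (∑-cong (allFin k) λ j → cong ⟦_⟧ (does-sym Fin._≟_ (c (tri a b d p q)) j))
  (Enum.once (finEnum k) (c (tri a b d p q)))) (sym (ordered-yes p q))

∑-χ-* : ∀ {n k} (c : Triple n → Fin k) (F : Vec Bool n → ℕ) →
  ∑ (allFin k) (λ j → ∑ (triples n) (λ (a , b , d) → χ c j a b d * F (vset a b d)))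
    ≡ ∑ (subsets n) (λ S → ⟦ does (size S ≟ 3) ⟧ * F S)
∑-χ-* {n} {k} c F = begin
  ∑ (allFin k) (λ j → ∑ (triples n) (λ (a , b , d) → χ c j a b d * F (vset a b d)))
    ≡⟨ ∑-swap (allFin k) (triples n) (λ j (a , b , d) → χ c j a b d * F (vset a b d)) ⟩
  ∑ (triples n) (λ (a , b , d) → ∑ (allFin k) (λ j → χ c j a b d * F (vset a b d)))
    ≡⟨ ∑-cong (triples n) (λ (a , b , d) → trans (∑-*ʳ (allFin k) (F (vset a b d)) (λ j → χ c j a b d))
         (cong (_* F (vset a b d)) (∑-χ c a b d))) ⟩
  ∑ (triples n) (λ (a , b , d) → ordered (toℕ a) (toℕ b) (toℕ d) * F (vset a b d))
    ≡⟨ ∑-ordered n F ⟩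
  ∑ (subsets n) (λ S → ⟦ does (size S ≟ 3) ⟧ * F S) ∎
  where open ≡-Reasoning

χ-size : ∀ {n k} (c : Triple n → Fin k) j a b d → χ c j a b d * size (vset a b d) ≡ χ c j a b d * 3
χ-size c j a b d with a Fin.<? b | b Fin.<? d
... | no _  | _     = refl
... | yes _ | no _  = refl
... | yes p | yes q = cong (⟦ does (c (tri a b d p q) Fin.≟ j) ⟧ *_) (size-triple p q (Fin.toℕ<n d))

fromSets : ∀ {n k} → (Vec Bool n → Fin k) → Triple n → Fin k
fromSets γ (tri a b d _ _) = γ (vset a b d)

χ-fromSets : ∀ {n k} (γ : Vec Bool n → Fin k) j a b d →
  χ (fromSets γ) j a b d ≡ ordered (toℕ a) (toℕ b) (toℕ d) * ⟦ does (γ (vset a b d) Fin.≟ j) ⟧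
χ-fromSets γ j a b d with a Fin.<? b | b Fin.<? d
... | no ≮  | _     = cong (_* ⟦ does (γ (vset a b d) Fin.≟ j) ⟧) (sym (ordered-noˡ {d = toℕ d} ≮))
... | yes _ | no ≮  = cong (_* ⟦ does (γ (vset a b d) Fin.≟ j) ⟧) (sym (ordered-noʳ ≮))
... | yes p | yes q = sym (trans (cong (_* ⟦ does (γ (vset a b d) Fin.≟ j) ⟧) (ordered-yes p q)) (*-identityˡ _))

deg-fromSets : ∀ {n k} (γ : Vec Bool n → Fin k) j v → deg (fromSets γ) j v ≡
  ∑ (subsets n) (λ S → ⟦ does (size S ≟ 3) ⟧ * (⟦ does (γ S Fin.≟ j) ⟧ * ⟦ mem S (toℕ v) ⟧))
deg-fromSets {n} γ j v = trans (deg-χ (fromSets γ) j v) (trans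
  (∑-cong (triples n) λ (a , b , d) → trans (cong (_* ⟦ mem (vset a b d) (toℕ v) ⟧) (χ-fromSets γ j a b d))
    (*-assoc (ordered (toℕ a) (toℕ b) (toℕ d)) _ _))
  (∑-ordered n (λ S → ⟦ does (γ S Fin.≟ j) ⟧ * ⟦ mem S (toℕ v) ⟧)))

module Split {k r n} (H : Amalgam k r n 0) (default : Fin k) where

  -- With no merged vertices left, a set of size three has row sum one and hence a unique colour;
  -- `default` is reached exactly on sets of other sizes.
  colourOf : Vec Bool n → Fin k
  colourOf S with Enum.search (finEnum k) (mult H S)
  ... | inj₁ (j , _) = j
  ... | inj₂ _       = default

  colourOf-mult : ∀ S j → size S ≡ 3 → ⟦ does (colourOf S Fin.≟ j) ⟧ ≡ mult H S j
  colourOf-mult S j s≡3 with Enum.search (finEnum k) (mult H S)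
  ... | inj₂ none = contradiction
          (trans (sym row-1) (trans (∑-cong (allFin k) none) (∑-0 (allFin k)))) λ ()
    where
    row-1 : ∑ (allFin k) (mult H S) ≡ 1
    row-1 = trans (rows H S) (cong (completions 0) s≡3)
  ... | inj₁ (i , pos) = trans (cong ⟦_⟧ (does-sym Fin._≟_ i j))
          (Enum.total-tight (finEnum k) δ≤mult (trans (Enum.once (finEnum k) i) (sym row-1)) j)
    where
    row-1 : ∑ (allFin k) (mult H S) ≡ 1
    row-1 = trans (rows H S) (cong (completions 0) s≡3)
    δ≤mult : ∀ x → Enum.δ (finEnum k) x i ≤ mult H S x
    δ≤mult x with x Fin.≟ i
    ... | yes refl = pos
    ... | no _     = z≤n

  colourOf-unique : ∀ S j → size S ≡ 3 → 0 < mult H S j → colourOf S ≡ j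
  colourOf-unique S j s≡3 pos with colourOf S Fin.≟ j | colourOf-mult S j s≡3
  ... | yes e | _ = e
  ... | no _  | e = contradiction pos (<-irrefl e)

  factor : ∀ j v → v < n →
    ∑ (subsets n) (λ S → ⟦ does (size S ≟ 3) ⟧ * (⟦ does (colourOf S Fin.≟ j) ⟧ * ⟦ mem S v ⟧)) ≡ r
  factor j v v<n = trans (∑-cong (subsets n) pointwise) (degrees H v v<n j)
    where
    pointwise : ∀ S → ⟦ does (size S ≟ 3) ⟧ * (⟦ does (colourOf S Fin.≟ j) ⟧ * ⟦ mem S v ⟧) ≡ ⟦ mem S v ⟧ * mult H S j
    pointwise S with size S ≟ 3
    ... | yes s≡3 rewrite s≡3 = trans (*-identityˡ _)
            (trans (cong (_* ⟦ mem S v ⟧) (colourOf-mult S j s≡3)) (*-comm (mult H S j) _))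
    ... | no s≢3 = trans (cong (_* (⟦ does (colourOf S Fin.≟ j) ⟧ * ⟦ mem S v ⟧)) not-3)
            (sym (trans (cong (⟦ mem S v ⟧ *_) (mult-0 H S j not-3)) (*-zeroʳ ⟦ mem S v ⟧)))
      where
      not-3 : completions 0 (size S) ≡ 0
      not-3 = cong ⟦_⟧ (dec-false (size S ≟ 3) s≢3)

-- Necessity of the four conditions

∑-deg : ∀ {n k} (c : Triple (suc n) → Fin k) v → ∑ (allFin k) (λ j → deg c j v) ≡ n C 2
∑-deg {n} {k} c v = begin
  ∑ (allFin k) (λ j → deg c j v)
    ≡⟨ ∑-cong (allFin k) (λ j → deg-χ c j v) ⟩
  ∑ (allFin k) (λ j → ∑ (triples (suc n)) (λ (a , b , d) → χ c j a b d * ⟦ mem (vset a b d) (toℕ v) ⟧))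
    ≡⟨ ∑-χ-* c (λ S → ⟦ mem S (toℕ v) ⟧) ⟩
  ∑ (subsets (suc n)) (λ S → completions 0 (size S) * ⟦ mem S (toℕ v) ⟧)
    ≡⟨ ∑-cong (subsets (suc n)) (λ S → *-comm (completions 0 (size S)) _) ⟩
  ∑ (subsets (suc n)) (λ S → ⟦ mem S (toℕ v) ⟧ * completions 0 (size S))
    ≡⟨ ∑-completions-mem n 0 (toℕ v) (Fin.toℕ<n v) ⟩
  completions (n + 0) 1
    ≡⟨ completions-1 (n + 0) ⟩
  (n + 0) C 2
    ≡⟨ cong (_C 2) (+-identityʳ n) ⟩
  n C 2 ∎
  where open ≡-Reasoning

handshake : ∀ {n k} (c : Triple n → Fin k) j →
  sumFin (deg c j) ≡ ∑ (triples n) (λ (a , b , d) → χ c j a b d) * 3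
handshake {n} c j = begin
  sumFin (deg c j)
    ≡⟨ sumFin-cong {n} (deg-χ c j) ⟩
  sumFin {n} (λ v → ∑ (triples n) (λ (a , b , d) → χ c j a b d * ⟦ mem (vset a b d) (toℕ v) ⟧))
    ≡⟨ sumFin-toℕ n (λ v → ∑ (triples n) (λ (a , b , d) → χ c j a b d * ⟦ mem (vset a b d) v ⟧)) ⟩
  ∑ (downFrom n) (λ v → ∑ (triples n) (λ (a , b , d) → χ c j a b d * ⟦ mem (vset a b d) v ⟧))
    ≡⟨ ∑-swap (downFrom n) (triples n) (λ v (a , b , d) → χ c j a b d * ⟦ mem (vset a b d) v ⟧) ⟩
  ∑ (triples n) (λ (a , b , d) → ∑ (downFrom n) (λ v → χ c j a b d * ⟦ mem (vset a b d) v ⟧))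
    ≡⟨ ∑-cong (triples n) (λ (a , b , d) → trans (∑-*ˡ (downFrom n) (χ c j a b d) _)
         (trans (cong (χ c j a b d *_) (∑-mem (vset a b d))) (χ-size c j a b d))) ⟩
  ∑ (triples n) (λ (a , b , d) → χ c j a b d * 3)
    ≡⟨ ∑-*ʳ (triples n) 3 _ ⟩
  ∑ (triples n) (λ (a , b , d) → χ c j a b d) * 3 ∎
  where open ≡-Reasoning

sumFin-mono : ∀ {n} {f g : Fin n → ℕ} → (∀ i → f i ≤ g i) → sumFin f ≤ sumFin g
sumFin-mono {zero}  h = z≤n
sumFin-mono {suc n} h = +-mono-≤ (h Fin.zero) (sumFin-mono (h ∘ Fin.suc))

sumFin-inject≤ : ∀ {m n} .(m≤n : m ≤ n) (f : Fin n → ℕ) → sumFin {m} (λ i → f (inject≤ i m≤n)) ≤ sumFin f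
sumFin-inject≤ {zero} m≤n f = z≤n
sumFin-inject≤ {suc m} {suc n} m≤n f = +-monoʳ-≤ (f Fin.zero) (sumFin-inject≤ {m} {n} _ (f ∘ Fin.suc))

mem-vset : ∀ {n} (a b d v : Fin n) →
  mem (vset a b d) (toℕ v) ≡ elem (toℕ v) (toℕ d ∷ toℕ b ∷ toℕ a ∷ [])
mem-vset a b d v = mem-setOf (toℕ d ∷ toℕ b ∷ toℕ a ∷ []) (Fin.toℕ<n v)

module _ {m n q k} .(m≤n : m ≤ n) (q≤k : q ≤ k) (col : Triple m → Fin q) (c : Triple n → Fin k)
  (ext : ∀ e → c (embTriple m≤n e) ≡ inject≤ (col e) q≤k) where

  private
    ι : Fin m → Fin n
    ι i = inject≤ i m≤n

  ι-mono : ∀ {a b : Fin m} → a Fin.< b → ι a Fin.< ι b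
  ι-mono {a} {b} = subst₂ _<_ (sym (Fin.toℕ-inject≤ a m≤n)) (sym (Fin.toℕ-inject≤ b m≤n))

  χ-extension : ∀ j a b d → χ col j a b d ≤ χ c (inject≤ j q≤k) (ι a) (ι b) (ι d)
  χ-extension j a b d with a Fin.<? b | b Fin.<? d
  ... | no _  | _    = z≤n
  ... | yes _ | no _ = z≤n
  ... | yes p | yes q with ι a Fin.<? ι b | ι b Fin.<? ι d
  ...   | no ≮  | _    = contradiction (ι-mono p) ≮
  ...   | yes _ | no ≮ = contradiction (ι-mono q) ≮
  ...   | yes _ | yes _ with col (tri a b d p q) Fin.≟ j | ext (tri a b d p q)
  ...     | no _     | _ = z≤n
  ...     | yes refl | e = ≤-reflexive (sym (cong ⟦_⟧ (dec-true (_ Fin.≟ _) e)))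

  deg-extension : ∀ j v → deg col j v ≤ deg c (inject≤ j q≤k) (ι v)
  deg-extension j v = ≤-trans
    (sumFin-mono λ a → ≤-trans (sumFin-mono λ b → ≤-trans (sumFin-mono λ d → term a b d)
      (sumFin-inject≤ m≤n λ d → contrib c j' (ι v) (ι a) (ι b) d))
      (sumFin-inject≤ m≤n λ b → sumFin λ d → contrib c j' (ι v) (ι a) b d))
    (sumFin-inject≤ m≤n λ a → sumFin λ b → sumFin λ d → contrib c j' (ι v) a b d)
    where
    j' = inject≤ j q≤k
    same-mem : ∀ a b d → mem (vset a b d) (toℕ v) ≡ mem (vset (ι a) (ι b) (ι d)) (toℕ (ι v))
    same-mem a b d
      rewrite mem-vset a b d v | mem-vset (ι a) (ι b) (ι d) (ι v)
            | Fin.toℕ-inject≤ a m≤n | Fin.toℕ-inject≤ b m≤n | Fin.toℕ-inject≤ d m≤n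
            | Fin.toℕ-inject≤ v m≤n = refl
    term : ∀ a b d → contrib col j v a b d ≤ contrib c j' (ι v) (ι a) (ι b) (ι d)
    term a b d = subst₂ _≤_ (sym (contrib-χ col j v a b d)) (sym (contrib-χ c j' (ι v) (ι a) (ι b) (ι d)))
      (*-mono-≤ (χ-extension j a b d) (≤-reflexive (cong ⟦_⟧ (same-mem a b d))))

-- Counting incidences in one colour, which exists as `1 ≤ q`, gives divisibility by three. Summing
-- the degrees of one vertex over all `k` colours gives `k * r = C(n,2)` for `suc n` vertices, hence
-- the second condition and, with `q ≤ k`, the third. Degrees can only grow under extension, which
-- gives the fourth.
necessity : ∀ {m n r q} .{{_ : NonZero r}} .(m≤n : m ≤ suc n) → 1 ≤ q → (col : Triple m → Fin q) →
  Embeds {m} {suc n} {q} m≤n r col →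
  (3 ∣ r * suc n) × (r ∣ (n C 2)) × (q ≤ (n C 2) / r) × (∀ (j : Fin q) (v : Fin m) → deg col j v ≤ r)
necessity {m} {n} {r} {q} m≤n 1≤q col (k , q≤k , c , ext , factor) =
    divides (∑ (triples (suc n)) λ (a , b , d) → χ c colour₀ a b d) (trans total-degree (handshake c colour₀))
  , divides k (sym k*r≡)
  , subst (λ x → q ≤ x / r) k*r≡ (subst (q ≤_) (sym (m*n/n≡m k r)) q≤k)
  , λ j v → subst (deg col j v ≤_) (factor (inject≤ j q≤k) (inject≤ v m≤n))
              (deg-extension m≤n q≤k col c ext j v)
  where
  colour₀ : Fin k
  colour₀ = fromℕ< (≤-trans 1≤q q≤k)
  total-degree : r * suc n ≡ sumFin (deg c colour₀)
  total-degree = trans (*-comm r (suc n))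
    (trans (sym (sumFin-const (suc n) r)) (sumFin-cong {suc n} λ v → sym (factor colour₀ v)))
  k*r≡ : k * r ≡ n C 2
  k*r≡ = trans (sym (∑-allFin-const k r))
    (trans (∑-cong (allFin k) λ j → sym (factor j Fin.zero)) (∑-deg c Fin.zero))

-- The given colouring as multiplicities, and embeddings from colourings of sets

module Given {m q k} (q≤k : q ≤ k) (col : Triple m → Fin q) where

  private
    module ES = Enum (subsetEnum m)

  widened : Triple m → Fin k
  widened e = inject≤ (col e) q≤k

  -- Summing over all triples with a delta on the vertex set avoids recovering an increasing triple
  -- from `S`.
  given : Vec Bool m → Fin k → ℕ
  given S j = ∑ (triples m) (λ (a , b , d) → χ widened j a b d * ES.δ S (vset a b d))

  given-row : ∀ S → ∑ (allFin k) (given S) ≡ ⟦ does (size S ≟ 3) ⟧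
  given-row S = begin
    ∑ (allFin k) (given S)
      ≡⟨ ∑-χ-* widened (ES.δ S) ⟩
    ∑ (subsets m) (λ S' → ⟦ does (size S' ≟ 3) ⟧ * ES.δ S S')
      ≡⟨ ∑-cong (subsets m) (λ S' → trans (*-comm ⟦ does (size S' ≟ 3) ⟧ _)
           (cong (λ b → ⟦ b ⟧ * ⟦ does (size S' ≟ 3) ⟧) (does-sym ES._≟ₑ_ S S'))) ⟩
    ∑ (subsets m) (λ S' → ES.δ S' S * ⟦ does (size S' ≟ 3) ⟧)
      ≡⟨ ES.total-δ (λ S' → ⟦ does (size S' ≟ 3) ⟧) S ⟩
    ⟦ does (size S ≟ 3) ⟧ ∎
    where open ≡-Reasoning

  given-degree : ∀ v j → ∑ (subsets m) (λ S → ⟦ mem S (toℕ v) ⟧ * given S j) ≡ deg widened j v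
  given-degree v j = begin
    ∑ (subsets m) (λ S → ⟦ mem S (toℕ v) ⟧ * given S j)
      ≡⟨ ∑-cong (subsets m) (λ S → sym (∑-*ˡ (triples m) ⟦ mem S (toℕ v) ⟧ _)) ⟩
    ∑ (subsets m) (λ S → ∑ (triples m) (λ (a , b , d) →
      ⟦ mem S (toℕ v) ⟧ * (χ widened j a b d * ES.δ S (vset a b d))))
      ≡⟨ ∑-swap (subsets m) (triples m) (λ S (a , b , d) →
           ⟦ mem S (toℕ v) ⟧ * (χ widened j a b d * ES.δ S (vset a b d))) ⟩
    ∑ (triples m) (λ (a , b , d) → ∑ (subsets m) (λ S →
      ⟦ mem S (toℕ v) ⟧ * (χ widened j a b d * ES.δ S (vset a b d))))
      ≡⟨ ∑-cong (triples m) (λ (a , b , d) → trans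
           (∑-cong (subsets m) λ S → rearrange ⟦ mem S (toℕ v) ⟧ (χ widened j a b d) (ES.δ S (vset a b d)))
           (ES.total-δ (λ S → χ widened j a b d * ⟦ mem S (toℕ v) ⟧) (vset a b d))) ⟩
    ∑ (triples m) (λ (a , b , d) → χ widened j a b d * ⟦ mem (vset a b d) (toℕ v) ⟧)
      ≡⟨ sym (deg-χ widened j v) ⟩
    deg widened j v ∎
    where
    open ≡-Reasoning
    rearrange : ∀ x y z → x * (y * z) ≡ z * (y * x)
    rearrange = solve-∀

  -- A positive degree exhibits a hyperedge of colour `j`, so `j` comes from one of the `q` given
  -- colours and has the same degree there; every further colour has degree zero.
  deg-widened : ∀ {r} → (∀ j v → deg col j v ≤ r) → ∀ j v → deg widened j v ≤ r
  deg-widened {r} bound j v with deg widened j v in e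
  ... | zero  = z≤n
  ... | suc _ with ∑-positive (triples m) _ (subst (0 <_) (trans (sym e) (deg-χ widened j v)) z<s)
  ...   | (a , b , d) , pos with colour-of a b d pos
    where
    colour-of : ∀ a b d → 0 < χ widened j a b d * ⟦ mem (vset a b d) (toℕ v) ⟧ → ∃[ i ] inject≤ i q≤k ≡ j
    colour-of a b d pos with a Fin.<? b | b Fin.<? d
    ... | yes p | yes q with widened (tri a b d p q) Fin.≟ j
    ...   | yes e = col (tri a b d p q) , e
  ...     | i , refl = subst (_≤ r) (trans (sym (same i v)) e) (bound i v)
    where
    same-χ : ∀ i a b d → χ widened (inject≤ i q≤k) a b d ≡ χ col i a b d
    same-χ i a b d with a Fin.<? b | b Fin.<? d
    ... | no _  | _     = refl
    ... | yes _ | no _  = refl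
    ... | yes p | yes q = cong ⟦_⟧ (does-⇔
            (mk⇔ (Fin.inject≤-injective q≤k q≤k _ _) (cong λ x → inject≤ x q≤k))
            (widened (tri a b d p q) Fin.≟ inject≤ i q≤k) (col (tri a b d p q) Fin.≟ i))
    same : ∀ i v → deg widened (inject≤ i q≤k) v ≡ deg col i v
    same i v = trans (deg-χ widened (inject≤ i q≤k) v) (trans
      (∑-cong (triples m) λ (a , b , d) → cong (_* ⟦ mem (vset a b d) (toℕ v) ⟧) (same-χ i a b d))
      (sym (deg-χ col i v)))

  given-positive : ∀ a b d (p : a Fin.< b) (q : b Fin.< d) → 0 < given (vset a b d) (widened (tri a b d p q))
  given-positive a b d p q = ≤-trans (≤-reflexive (sym one))
    (term≤∑ (λ (x , y , z) → χ widened (widened (tri a b d p q)) x y z * ES.δ (vset a b d) (vset x y z))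
      (∈-cartesianProduct⁺ (∈-allFin a) (∈-cartesianProduct⁺ (∈-allFin b) (∈-allFin d))))
    where
    one : χ widened (widened (tri a b d p q)) a b d * ES.δ (vset a b d) (vset a b d) ≡ 1
    one with a Fin.<? b | b Fin.<? d
    ... | no ≮  | _     = contradiction p ≮
    ... | yes _ | no ≮  = contradiction q ≮
    ... | yes _ | yes _ = cong₂ _*_
            (cong ⟦_⟧ (dec-true (widened (tri a b d p q) Fin.≟ widened (tri a b d p q)) refl))
            (ES.δ-refl (vset a b d))

  embeds : ∀ {n r} .(m≤n : m ≤ n) (γ : Vec Bool n → Fin k) →
    (∀ j v → v < n →
      ∑ (subsets n) (λ S → ⟦ does (size S ≟ 3) ⟧ * (⟦ does (γ S Fin.≟ j) ⟧ * ⟦ mem S v ⟧)) ≡ r) →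
    (∀ a b d (p : a Fin.< b) (q : b Fin.< d) →
      γ (setOf n (toℕ d ∷ toℕ b ∷ toℕ a ∷ [])) ≡ widened (tri a b d p q)) →
    Embeds m≤n r col
  embeds {n} m≤n γ factor agree = k , q≤k , fromSets γ , ext
    , λ j v → trans (deg-fromSets γ j v) (factor j (toℕ v) (Fin.toℕ<n v))
    where
    ext : ∀ e → fromSets γ (embTriple m≤n e) ≡ widened e
    ext (tri a b d p q)
      rewrite Fin.toℕ-inject≤ a m≤n | Fin.toℕ-inject≤ b m≤n | Fin.toℕ-inject≤ d m≤n =
      agree a b d (recompute (a Fin.<? b) p) (recompute (b Fin.<? d) q)

-- Arithmetic of the bound on `n`

two-C : ∀ x → 2 * (x C 2) + x ≡ x * x
two-C zero = refl
two-C (suc x) = begin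
  2 * (suc x C 2) + suc x             ≡⟨ cong (λ y → 2 * y + suc x) (sym (nCk+nC[k+1]≡[n+1]C[k+1] x 1)) ⟩
  2 * (x C 1 + x C 2) + suc x         ≡⟨ cong (λ y → 2 * (y + x C 2) + suc x) (nC1≡n x) ⟩
  2 * (x + x C 2) + suc x             ≡⟨ rearrange x (x C 2) ⟩
  (2 * (x C 2) + x) + suc (x + x)     ≡⟨ cong (_+ suc (x + x)) (two-C x) ⟩
  x * x + suc (x + x)                 ≡⟨ square x ⟩
  suc x * suc x                       ∎
  where
  open ≡-Reasoning
  rearrange : ∀ x y → 2 * (x + y) + suc x ≡ (2 * y + x) + suc (x + x)
  rearrange = solve-∀
  square : ∀ x → x * x + suc (x + x) ≡ suc x * suc x
  square = solve-∀

-- The hypothesis on n = 2m + e, m = l + 1, cleared of subtractions.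
module Arithmetic (l e : ℕ) (bound : 8 * suc l * suc l < (2 * e + 1) * (2 * e + 1) + 16 * suc l + 7) where

  quadratic : 2 * (l * l) < e * e + e + 4
  quadratic = *-cancelˡ-< 4 _ _ (+-cancelʳ-< (16 * l + 8) _ _ (subst₂ _<_ (lhs l) (rhs l e) bound))
    where
    lhs : ∀ l → 8 * suc l * suc l ≡ 4 * (2 * (l * l)) + (16 * l + 8)
    lhs = solve-∀
    rhs : ∀ l e → (2 * e + 1) * (2 * e + 1) + 16 * suc l + 7 ≡ 4 * (e * e + e + 4) + (16 * l + 8)
    rhs = solve-∀

  -- Equivalent to `quadratic`: after doubling and removing the binomials by `two-C`, both
  -- inequalities differ by the common summand `K`. On the left stand all hyperedges at a vertex; on
  -- the right, the binomial counts those joining an old vertex to two new ones.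
  few-edges : (l + (suc l + e)) C 2 < 2 * ((suc l + e) C 2) + 2
  few-edges = ≰⇒> λ h → <⇒≱ quadratic (+-cancelʳ-≤ (K l e) _ _ (begin
    (e * e + e + 4) + K l e         ≡⟨ left l e ⟩
    2 * (P * P) + 4 + X             ≡⟨ cong (λ y → 2 * y + 4 + X) (sym (two-C P)) ⟩
    2 * (2 * (P C 2) + P) + 4 + X   ≡⟨ middle (P C 2) P X ⟩
    2 * (2 * (P C 2) + 2) + (2 * P + X) ≤⟨ +-monoˡ-≤ (2 * P + X) (*-monoʳ-≤ 2 h) ⟩
    2 * (X C 2) + (2 * P + X)       ≡⟨ shuffle (2 * (X C 2)) (2 * P) X ⟩
    (2 * (X C 2) + X) + 2 * P       ≡⟨ cong (_+ 2 * P) (two-C X) ⟩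
    X * X + 2 * P                   ≡⟨ right l e ⟩
    2 * (l * l) + K l e             ∎))
    where
    open ≤-Reasoning
    P = suc l + e
    X = l + (suc l + e)
    K : ℕ → ℕ → ℕ
    K l e = 2 * (l * l) + 4 * (l * suc e) + (e * e + 4 * e + 3 + 2 * l)
    left : ∀ l e → (e * e + e + 4) + (2 * (l * l) + 4 * (l * suc e) + (e * e + 4 * e + 3 + 2 * l))
                   ≡ 2 * ((suc l + e) * (suc l + e)) + 4 + (l + (suc l + e))
    left = solve-∀
    middle : ∀ c P X → 2 * (2 * c + P) + 4 + X ≡ 2 * (2 * c + 2) + (2 * P + X)
    middle = solve-∀
    shuffle : ∀ x y z → x + (y + z) ≡ (x + z) + y
    shuffle = solve-∀
    right : ∀ l e → (l + (suc l + e)) * (l + (suc l + e)) + 2 * (suc l + e)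
                    ≡ 2 * (l * l) + (2 * (l * l) + 4 * (l * suc e) + (e * e + 4 * e + 3 + 2 * l))
    right = solve-∀

  -- If `e ≤ l`, then `quadratic` would put `2 * (l * l)` below `l * l + l + 4`, impossible from
  -- `l = 3` on. At `l = e = 2` the conclusion fails although `quadratic` holds, hence the separate
  -- treatment of `m ≤ 3`.
  m≤e : 3 ≤ l → suc l ≤ e
  m≤e 3≤l = ≰⇒> λ e≤l → <⇒≱ quadratic (begin
    e * e + e + 4       ≤⟨ +-monoˡ-≤ 4 (+-mono-≤ (*-mono-≤ e≤l e≤l) e≤l) ⟩
    l * l + l + 4       ≤⟨ +-monoʳ-≤ (l * l + l) (≤-trans (n≤1+n 4) (≤-trans (n≤1+n 5) (*-monoʳ-≤ 2 3≤l))) ⟩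
    l * l + l + 2 * l   ≡⟨ rearrange l ⟩
    l * l + 3 * l       ≤⟨ +-monoʳ-≤ (l * l) (*-monoˡ-≤ l 3≤l) ⟩
    l * l + l * l       ≡⟨ cong (l * l +_) (sym (+-identityʳ _)) ⟩
    2 * (l * l)         ∎)
    where
    open ≤-Reasoning
    rearrange : ∀ l → l * l + l + 2 * l ≡ l * l + 3 * l
    rearrange = solve-∀

-- Both sides tripled count the incidences of vertices and hyperedges, once by classes and once by
-- vertices.
edge-count : ∀ n k r t → k * r ≡ n C 2 → r * suc n ≡ 3 * t → k * t ≡ completions (suc n) 0
edge-count n k r t kr rn = *-cancelˡ-≡ _ _ 3 (begin
  3 * (k * t)                 ≡⟨ swap 3 k t ⟩
  k * (3 * t)                 ≡⟨ cong (k *_) (sym rn) ⟩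
  k * (r * suc n)             ≡⟨ rotate k r (suc n) ⟩
  suc n * (k * r)             ≡⟨ cong (suc n *_) (trans kr (sym (completions-1 n))) ⟩
  suc n * completions n 1     ≡⟨ sym (completions-absorb n 0) ⟩
  3 * completions (suc n) 0   ∎)
  where
  open ≡-Reasoning
  swap : ∀ a b c → a * (b * c) ≡ b * (a * c)
  swap = solve-∀
  rotate : ∀ a b c → a * (b * c) ≡ c * (a * b)
  rotate = solve-∀

-- At most three old vertices

-- With every vertex merged the empty set is the only type, and giving each colour `t` hyperedges
-- meets all conditions. Detaching completely then proves that an `r`-factorization exists at all.
pointAmalgam : ∀ {k r n t} → k * t ≡ completions n 0 → r * n ≡ 3 * t → Amalgam k r 0 n
pointAmalgam {k} {r} {n} {t} kt rn = record
  { mult = λ _ _ → t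
  ; rows = λ { [] → trans (∑-allFin-const k t) kt }
  ; degrees = λ _ ()
  ; weights = λ _ → trans (+-identityʳ (3 * t)) (sym rn)
  }

transpose-hit : ∀ {k} (i j : Fin k) → Components.transpose i j i ≡ j
transpose-hit i j rewrite dec-true (i Fin.≟ i) refl = refl

-- Exchanging two colours only permutes the classes, so each of them is again an `r`-factor.
factor-transpose : ∀ {n k r} (γ : Vec Bool n → Fin k) i i' →
  (∀ j v → v < n →
    ∑ (subsets n) (λ S → ⟦ does (size S ≟ 3) ⟧ * (⟦ does (γ S Fin.≟ j) ⟧ * ⟦ mem S v ⟧)) ≡ r) →
  (∀ j v → v < n →
    ∑ (subsets n) (λ S → ⟦ does (size S ≟ 3) ⟧ *
      (⟦ does (Components.transpose i i' (γ S) Fin.≟ j) ⟧ * ⟦ mem S v ⟧)) ≡ r)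
factor-transpose {n} γ i i' factor j v v<n = trans
  (∑-cong (subsets n) λ S → cong (λ b → ⟦ does (size S ≟ 3) ⟧ * (⟦ b ⟧ * ⟦ mem S v ⟧)) (does-⇔
    (mk⇔ (λ e → trans (sym (Components.transpose-inverse i' i)) (cong (Components.transpose i' i) e))
         (λ e → trans (cong (Components.transpose i i') e) (Components.transpose-inverse i i')))
    (Components.transpose i i' (γ S) Fin.≟ j) (γ S Fin.≟ Components.transpose i' i j)))
  (factor (Components.transpose i' i j) v v<n)

third≥2 : ∀ {a b d : ℕ} → a < b → b < d → 2 ≤ d
third≥2 a<b b<d = ≤-trans (s≤s (≤-trans (s≤s z≤n) a<b)) b<d

-- For m ≤ 3 there is at most one given hyperedge, so any factorization works after
-- exchanging two colours.
small : ∀ {m n r q k t} .(m≤n : m ≤ n) (q≤k : q ≤ k) → 1 ≤ q → (col : Triple m → Fin q) → m ≤ 3 →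
  k * t ≡ completions n 0 → r * n ≡ 3 * t → Embeds {m} {n} {q} m≤n r col
small {m} {n} {r} {q} {k} m≤n q≤k 1≤q col m≤3 kt rn with m ≟ 3
-- An increasing triple has last entry at least 2 and so needs three old vertices; here agreement
-- with the given colouring is vacuous.
... | no m≢3 = embeds m≤n colourOf factor λ a b d p q →
    contradiction (≤-antisym m≤3 (≤-trans (s≤s (third≥2 p q)) (Fin.toℕ<n d))) m≢3
  where
  open Given q≤k col
  open Split (proj₁ (detachAll n (+-identityʳ n) (pointAmalgam {r = r} kt rn))) (fromℕ< (≤-trans 1≤q q≤k))
... | yes refl = embeds m≤n (Components.transpose (colourOf S₀) j₀ ∘ colourOf)
      (factor-transpose colourOf (colourOf S₀) j₀ factor) agree
  where
  open Given q≤k col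
  open Split (proj₁ (detachAll n (+-identityʳ n) (pointAmalgam {r = r} kt rn))) (fromℕ< (≤-trans 1≤q q≤k))
  -- The only hyperedge inside the old part; its colour in the factorization is exchanged with the
  -- prescribed `j₀`.
  S₀ : Vec Bool n
  S₀ = setOf n (2 ∷ 1 ∷ 0 ∷ [])
  j₀ : Fin k
  j₀ = widened (tri Fin.zero (Fin.suc Fin.zero) (Fin.suc (Fin.suc Fin.zero)) (s≤s z≤n) (s≤s (s≤s z≤n)))
  agree : ∀ a b d (p : a Fin.< b) (q : b Fin.< d) →
    Components.transpose (colourOf S₀) j₀ (colourOf (setOf n (toℕ d ∷ toℕ b ∷ toℕ a ∷ [])))
      ≡ widened (tri a b d p q)
  agree a b d p q with first | second | third
    where
    third′ : toℕ d ≡ 2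
    third′ = ≤-antisym (≤-pred (Fin.toℕ<n d)) (third≥2 p q)
    second′ : toℕ b ≡ 1
    second′ = ≤-antisym (≤-pred (subst (toℕ b <_) third′ q)) (≤-trans (s≤s z≤n) p)
    third : d ≡ Fin.suc (Fin.suc Fin.zero)
    third = Fin.toℕ-injective third′
    second : b ≡ Fin.suc Fin.zero
    second = Fin.toℕ-injective second′
    first : a ≡ Fin.zero
    first = Fin.toℕ-injective (n<1⇒n≡0 (subst (toℕ a <_) second′ p))
  ... | refl | refl | refl = transpose-hit (colourOf S₀) j₀

-- At least four old vertices, and the equivalence

module Large {l e q k r t : ℕ} (q≤k : q ≤ k) (1≤q : 1 ≤ q) (col : Triple (suc l) → Fin q)
  (few : (l + (suc l + e)) C 2 < 2 * ((suc l + e) C 2) + 2) (m≤e : suc l ≤ e)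
  (kr : k * r ≡ (l + (suc l + e)) C 2) (rn : r * (suc l + (suc l + e)) ≡ 3 * t)
  (bound : ∀ j v → deg col j v ≤ r) where

  private
    m = suc l
    p = suc l + e
    n = m + p

  open Given q≤k col

  degree-bound : ∀ v → v < m → ∀ j → ∑ (subsets m) (λ S → ⟦ mem S v ⟧ * given S j) ≤ r
  degree-bound v v<m j = subst
    (λ u → ∑ (subsets m) (λ S → ⟦ mem S u ⟧ * given S j) ≤ r) (Fin.toℕ-fromℕ< v<m)
    (subst (_≤ r) (sym (given-degree (fromℕ< v<m) j)) (deg-widened bound j (fromℕ< v<m)))

  slack : k * r < 2 * completions p 1 + 2
  slack = subst₂ (λ x y → x < 2 * y + 2) (sym kr) (sym (completions-1 p)) few

  edges-at : ∀ v → v < m → ∑ (subsets m) (λ S → ⟦ mem S v ⟧ * completions p (size S)) ≡ k * r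
  edges-at v v<m = trans (∑-completions-mem l p v v<m) (trans (completions-1 (l + p)) (sym kr))

  edges : ∑ (subsets m) (λ S → completions p (size S)) ≡ k * t
  edges = trans (∑-completions m p 0) (sym (edge-count (l + p) k r t kr rn))

  2m≤p : 2 * m ≤ p
  2m≤p = +-monoʳ-≤ m (subst (_≤ e) (sym (+-identityʳ m)) m≤e)

  open Start given given-row degree-bound slack edges-at edges rn 2m≤p

  detached : ∃[ H ] (∀ xs j → All (_< m) xs → size (setOf m xs) ≡ 3 →
    mult {k} {r} {n} {0} H (setOf n xs) j ≡ mult amalgam (setOf m xs) j)
  detached = detachAll p (+-comm p m) amalgam

  open Split (proj₁ detached) (fromℕ< (≤-trans 1≤q q≤k))

  agree : ∀ a b d (p : a Fin.< b) (q : b Fin.< d) →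
    -- The prescribed colour has positive multiplicity in `given`, keeps it in the amalgam and
    -- through all detachments, and at the end a positive multiplicity determines the colour.
    colourOf (setOf n (toℕ d ∷ toℕ b ∷ toℕ a ∷ [])) ≡ widened (tri a b d p q)
  agree a b d a<b b<d = colourOf-unique (setOf n xs) j
    (size-triple a<b b<d (≤-trans (Fin.toℕ<n d) (m≤m+n m p)))
    (subst (0 <_) (sym (proj₂ detached xs j
        (Fin.toℕ<n d ∷ Fin.toℕ<n b ∷ Fin.toℕ<n a ∷ []) (size-triple a<b b<d (Fin.toℕ<n d))))
      (≤-trans (given-positive a b d a<b b<d) (amalgam-extends (vset a b d) j)))
    where
    xs = toℕ d ∷ toℕ b ∷ toℕ a ∷ []
    j = widened (tri a b d a<b b<d)

  embedding : .(m≤n : m ≤ n) → Embeds m≤n r col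
  embedding m≤n = embeds m≤n colourOf factor agree

theorem3p1 : (m n r q : ℕ) → .{{_ : NonZero r}} → 1 ≤ m → 1 ≤ n → 1 ≤ q →
    -- n > 2m + (-1 + √(8m² - 16m - 7))/2, i.e. 2n - 4m + 1 > √(8m² - 16m - 7):
    (h : 4 * m < 2 * n + 1) →
    8 * m * m < (2 * n + 1 ∸ 4 * m) * (2 * n + 1 ∸ 4 * m) + 16 * m + 7 →
    (col : Triple m → Fin q) →
    Embeds {m} {n} {q} (bound⇒m≤n h) r col
    ⇔ ((3 ∣ r * n) × (r ∣ ((n ∸ 1) C 2)) × (q ≤ ((n ∸ 1) C 2) / r)
    × (∀ (j : Fin q) (v : Fin m) → deg col j v ≤ r))
theorem3p1 m@(suc l) n r q _ 1≤n 1≤q h bound col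
  with m≤n⇒∃[o]m+o≡n {m} {n} (bound⇒m≤n h)
... | p , refl with m≤n⇒∃[o]m+o≡n {m} {p} m≤p
  where
  double : ∀ m p → 2 * (m + p) + 1 ≡ suc (2 * m + 2 * p)
  double = solve-∀
  four : ∀ m → 4 * m ≡ 2 * m + 2 * m
  four = solve-∀
  m≤p : m ≤ p
  m≤p = *-cancelˡ-≤ 2 (+-cancelˡ-≤ (2 * m) _ _ (≤-pred (subst₂ _<_ (four m) (double m p) h)))
... | e , refl = mk⇔ (necessity (bound⇒m≤n h) 1≤q col) sufficiency
  where
  regroup : ∀ m e → 2 * (m + (m + e)) + 1 ≡ (2 * e + 1) + 4 * m
  regroup = solve-∀
  -- With `n = m + (m + e)` the difference `2 * n + 1 ∸ 4 * m` is not truncated and equals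
  -- `2 * e + 1`.
  open Arithmetic l e (subst (λ x → 8 * m * m < x * x + 16 * m + 7)
    (trans (cong (_∸ 4 * m) (regroup m e)) (m+n∸n≡m (2 * e + 1) (4 * m))) bound)
  sufficiency : (3 ∣ r * (m + (m + e))) × (r ∣ ((l + (m + e)) C 2)) × (q ≤ ((l + (m + e)) C 2) / r)
    × (∀ (j : Fin q) (v : Fin m) → deg col j v ≤ r) → Embeds {m} {m + (m + e)} {q} (bound⇒m≤n h) r col
  sufficiency (divides t rn , r∣C , q≤k , degrees≤r) = embedding
    where
    -- The only possible number of classes, since the degrees of one vertex must add up to
    -- `C(n-1,2)`.
    k = ((l + (m + e)) C 2) / r
    kr : k * r ≡ (l + (m + e)) C 2
    kr = m/n*n≡m r∣C
    rn′ : r * (m + (m + e)) ≡ 3 * t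
    rn′ = trans rn (*-comm t 3)
    embedding : Embeds {m} {m + (m + e)} {q} (bound⇒m≤n h) r col
    embedding with m ≤? 3
    ... | yes m≤3 = small {t = t} (bound⇒m≤n h) q≤k 1≤q col m≤3
            (edge-count (l + (m + e)) k r t kr rn′) rn′
    ... | no m≰3 = Large.embedding {t = t} q≤k 1≤q col few-edges (m≤e (≤-pred (≰⇒> m≰3)))
            kr rn′ degrees≤r (bound⇒m≤n h)
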